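{- Let $R=\lambda/\mu\in\mathcal R_m$ with $\ell(\lambda)=n$, and let $I\subseteq[n-1]$. Let $R_I$ be the unique ribbon in $\mathcal R_m$ with $\mathrm{Des}(R_I)=d([n-1]\setminus I,R)$. Then \[\mathrm{Imm}_{\tau(I)}\left(\mathrm{JT}^n_R(\mathbf x^{(1)})*\cdots*\mathrm{JT}^n_R(\mathbf x^{(k)})\right)=\det\left(\mathrm{JT}_{R_I}(\mathbf x^{(1)})*\cdots*\mathrm{JT}_{R_I}(\mathbf x^{(k)})\right).\]
   Context: $e_d$ are elementary symmetric functions ($e_0=1$, $e_d=0$ for $d<0$); for a skew shape $\lambda/\mu$ (cells $(i,j)$ with $\mu_i<j\le\lambda_i$), $\mathrm{JT}^n_{\lambda/\mu}(\mathbf x)=(e_{\lambda_i-\mu_j-i+j}(\mathbf x))_{i,j=1}^n$ for $n\ge\ell(\lambda)$, and $\det\mathrm{JT}_{\lambda/\mu}$ of a Hadamard product means this determinant for any such $n$ (independent of $n$); $*$ is the entrywise product, for distinct variable sets. $\mathrm{Imm}_f(M)=\sum_{w\in\mathfrak S_n}f(w)\prod_iM_{i,w(i)}$. $\mathrm{TL}_n(2)$ is generated by $t_1,\dots,t_{n-1}$ with $t_i^2=2t_i$, $t_it_jt_i=t_i$ ($|i-j|=1$), $t_it_j=t_jt_i$ ($|i-j|\ge2$), with basis $\mathcal B_n$ of Kauffman diagrams; $\theta:\mathbb C[\mathfrak S_n]\to\mathrm{TL}_n(2)$, $\theta(s_i)=t_i-1$; $f_\tau(w)$ = coefficient of $\tau$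 in $\theta(w)$; $\mathrm{Imm}_\tau=\mathrm{Imm}_{f_\tau}$; $\tau(I)=\prod_{i\in I}t_i$ in increasing order. A ribbon is a connected skew shape with no $2\times2$ block. $\mathcal R_m$ is the set of ribbons $\lambda/\mu$ of size $m$ with $\{i:\lambda_i>\mu_i\}=[1,\ell(\lambda)]$; $R\mapsto\mathrm{Des}(R)$ is a bijection from $\mathcal R_m$ to subsets of $[m-1]$. For such $R$ let $N_i=\sum_{j\le i}(\lambda_j-\mu_j)$; $\mathrm{Des}(R)=\{N_i:i\in[1,\ell(\lambda)-1]\}$ (equivalently: labelling cells $1..m$ along the ribbon from the top-right cell, $i$ is a descent iff cell $i$ is directly above cell $i+1$), and $d(J,R)=\{N_i:i\in J\}$. -}

module Defs where

open import Algebra.Bundles using (CommutativeRing; Semiring)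
open import Data.Bool.Base using (if_then_else_; _∧_)
open import Data.Fin.Base as Fin using (Fin; zero; suc; toℕ; inject₁; _↑ˡ_; _↑ʳ_)
open import Data.Fin.Permutation as Perm using (Permutation′; _∘ₚ_; _⟨$⟩ʳ_; transpose; insert)
import Data.Fin.Properties as Fin
open import Data.Fin.Subset using (Subset; ∣_∣; _∈_; inside; outside)
open import Data.Fin.Subset.Properties using (_∈?_)
open import Data.Integer.Base as ℤ using (ℤ; +_; -[1+_])
open import Data.List.Base as List using (List; []; _∷_; length; map; filter; foldr; foldl; allFin; cartesianProductWith)
open import Data.List.Relation.Unary.All using (All)
open import Data.List.Relation.Unary.Linked using (Linked)
open import Data.Nat.Base as ℕ using (ℕ; zero; suc; _+_; _∸_; _≤_; _<_; _≥_)
import Data.Nat.Properties as ℕ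
open import Algebra.Definitions.RawMonoid ℕ.+-0-rawMonoid using () renaming (sum to ∑ℕ)
open import Data.Product.Base using (∃; _×_; _,_; proj₁; proj₂)
open import Data.Sum.Base using ([_,_]′)
open import Data.Vec.Base using (Vec; []; _∷_; lookup; tabulate)
import Data.Vec.Properties as Vec
open import Function.Base using (_∘_)
open import Function.Bundles using (_⇔_)
open import Level using (Level; _⊔_)
open import Relation.Binary.Construct.Closure.Equivalence using (EqClosure)
open import Relation.Binary.PropositionalEquality using (_≡_)
open import Relation.Nullary using (¬_; does)
open import Relation.Unary using (Pred)

private
  variable
    n : ℕ

-- Rows and columns are numbered from 0.

record Partition : Set where
  field
    parts      : List ℕ
    positive   : All (0 <_) parts
    decreasing : Linked _≥_ parts

open Partition public

ℓ : Partition → ℕ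
ℓ = length ∘ parts

nth : List ℕ → ℕ → ℕ
nth []       _       = 0
nth (p ∷ _)  zero    = p
nth (_ ∷ ps) (suc i) = nth ps i

part : Partition → ℕ → ℕ
part = nth ∘ parts

record SkewShape : Set where
  field
    outer inner : Partition
    inner⊆outer : ∀ i → part inner i ≤ part outer i

open SkewShape public

Cell : Set
Cell = ℕ × ℕ

infix 4 _∈ˢ_

-- With 0-based columns the condition μᵢ < j ≤ λᵢ becomes μᵢ ≤ j < λᵢ.
_∈ˢ_ : Cell → SkewShape → Set
(i , j) ∈ˢ R = part (inner R) i ≤ j × j < part (outer R) i

data Neighbour (R : SkewShape) : Cell → Cell → Set where
  right : ∀ {i j} → (i , j) ∈ˢ R → (i , suc j) ∈ˢ R → Neighbour R (i , j) (i , suc j)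
  below : ∀ {i j} → (i , j) ∈ˢ R → (suc i , j) ∈ˢ R → Neighbour R (i , j) (suc i , j)

Connected : SkewShape → Set
Connected R = ∀ {p q} → p ∈ˢ R → q ∈ˢ R → EqClosure (Neighbour R) p q

No2×2 : SkewShape → Set
No2×2 R = ∀ i j → ¬ ((i , j) ∈ˢ R × (i , suc j) ∈ˢ R × (suc i , j) ∈ˢ R × (suc i , suc j) ∈ˢ R)

-- N R i is the number of cells in the first i rows.
N : SkewShape → ℕ → ℕ
N R zero    = 0
N R (suc i) = N R i + (part (outer R) i ∸ part (inner R) i)

size : SkewShape → ℕ
size R = N R (ℓ (outer R))

infix 4 _∈𝓡_

record _∈𝓡_ (R : SkewShape) (m : ℕ) : Set where
  field
    connected    : Connected R
    no2×2        : No2×2 R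
    size≡        : size R ≡ m
    nonemptyRows : ∀ i → part (inner R) i < part (outer R) i ⇔ i < ℓ (outer R)

Des : SkewShape → Pred ℕ _
Des R x = ∃ λ i → 1 ≤ i × i < ℓ (outer R) × x ≡ N R i

-- j : Fin p stands for the number 1 + toℕ j, so that Subset p models the
-- subsets of {1, …, p}.
d : ∀ {p} → Subset p → SkewShape → Pred ℕ _
d J R x = ∃ λ j → j ∈ J × x ≡ N R (suc (toℕ j))

-- Each permutation of Fin n occurs exactly once (up to Perm._≈_).
permutations : ∀ n → List (Permutation′ n)
permutations zero    = Perm.id ∷ []
permutations (suc n) = cartesianProductWith (insert zero) (allFin (suc n)) (permutations n)

inversions : Permutation′ n → ℕ
inversions w = ∑ℕ λ i → ∑ℕ λ j →
  if does (i Fin.<? j) ∧ does ((w ⟨$⟩ʳ j) Fin.<? (w ⟨$⟩ʳ i)) then 1 else 0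

-- i : Fin (n ∸ 1) indexes the generators sᵢ and tᵢ; lo i and hi i are the
-- two consecutive positions that they act on.
lo hi : Fin (n ∸ 1) → Fin n
lo {suc n} i = inject₁ i
hi {suc n} i = suc i

s : Fin (n ∸ 1) → Permutation′ n
s i = transpose (lo i) (hi i)

subsets : ∀ n → List (Subset n)
subsets zero    = [] ∷ []
subsets (suc n) = map (outside ∷_) (subsets n) List.++ map (inside ∷_) (subsets n)

-- Symmetric functions are evaluated at finitely many elements of an
-- arbitrary commutative ring.  An identity of symmetric functions is an
-- identity of polynomials in every finite number of variables; those are
-- the instances where A is a polynomial ring and x lists its variables.
module Immanants {a ℓa : Level} (A : CommutativeRing a ℓa) where

  open CommutativeRing A using (Carrier; _*_; 0#; 1#; -_; semiring)
    renaming (_+_ to _+ᴬ_)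
  open import Algebra.Definitions.RawSemiring (Semiring.rawSemiring semiring) using (product; _^_)

  ∑ : List Carrier → Carrier
  ∑ = foldr _+ᴬ_ 0#

  e : (d : ℕ) {v : ℕ} → (Fin v → Carrier) → Carrier
  e d {v} x = ∑ (map monomial (filter (λ S → ∣ S ∣ ℕ.≟ d) (subsets v)))
    where
    monomial : Subset v → Carrier
    monomial S = product λ i → if lookup S i then x i else 1#

  eℤ : ℤ → {v : ℕ} → (Fin v → Carrier) → Carrier
  eℤ (+ d)    x = e d x
  eℤ -[1+ _ ] x = 0#

  Matrix : ℕ → Set a
  Matrix n = Fin n → Fin n → Carrier

  JT : SkewShape → (n : ℕ) {v : ℕ} → (Fin v → Carrier) → Matrix n
  JT R n x i j = eℤ (+ part (outer R) (toℕ i) ℤ.- + part (inner R) (toℕ j) ℤ.- + toℕ i ℤ.+ + toℕ j) x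

  Hadamard : ∀ {k} → (Fin k → Matrix n) → Matrix n
  Hadamard M i j = product λ r → M r i j

  Imm : (Permutation′ n → Carrier) → Matrix n → Carrier
  Imm f M = ∑ (map (λ w → f w * product λ i → M i (w ⟨$⟩ʳ i)) (permutations _))

  det : Matrix n → Carrier
  det = Imm λ w → (- 1#) ^ inversions w

module Diagrams (n : ℕ) where

  -- A matching of the n top points, numbered 0, …, n-1, and the n bottom
  -- points, numbered n, …, 2n-1, given by the vector of partners.
  Matching : Set
  Matching = Vec (Fin (n + n)) (n + n)

  identity : Matching
  identity = tabulate ([ n ↑ʳ_ , _↑ˡ n ]′ ∘ Fin.splitAt n)

  bottomLo bottomHi : Fin (n ∸ 1) → Fin (n + n)
  bottomLo i = n ↑ʳ lo i
  bottomHi i = n ↑ʳ hi i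

  -- Drawing the diagram of tᵢ below D closes a loop if D joins the bottom
  -- points i and i+1.  Otherwise the partners of these two points become
  -- joined.  In both cases i and i+1 are joined in the result.
  closesLoop : Fin (n ∸ 1) → Matching → Set
  closesLoop i D = lookup D (bottomLo i) ≡ bottomHi i

  stack : Matching → Fin (n ∸ 1) → Matching
  stack D i = tabulate λ q →
    if does (q Fin.≟ bottomLo i) then bottomHi i else
    if does (q Fin.≟ bottomHi i) then bottomLo i else
    if does (q Fin.≟ lookup D (bottomLo i)) then lookup D (bottomHi i) else
    if does (q Fin.≟ lookup D (bottomHi i)) then lookup D (bottomLo i) else
    lookup D q

  -- A word i₁ i₂ … iₗ stands for the product of tᵢ₁, tᵢ₂, …, tᵢₗ, drawn from
  -- top to bottom.
  Word : Set
  Word = List (Fin (n ∸ 1))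

  diagram : Word → Matching
  diagram = foldl stack identity

  data NoLoopBelow (D : Matching) : Word → Set where
    []  : NoLoopBelow D []
    _∷_ : ∀ {i v} → ¬ closesLoop i D → NoLoopBelow (stack D i) v → NoLoopBelow D (i ∷ v)

  -- A product of generators without closed loops is an element of the basis
  -- 𝓑ₙ, and it is determined by its Kauffman diagram.  All the Kauffman
  -- diagrams (non-crossing perfect matchings) arise in this way.
  record BasisProduct : Set where
    field
      word     : Word
      loopFree : NoLoopBelow identity word

  open BasisProduct public

  increasing : Subset (n ∸ 1) → Word
  increasing I = filter (_∈? I) (allFin _)

  -- The Kauffman diagram of τ(I).
  τ : Subset (n ∸ 1) → Matching
  τ I = diagram (increasing I)

-- TLₙ(2), with ι the structure map, is the free K-algebra on the generators
-- tᵢ modulo _≋_.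
module TemperleyLieb {c ℓc : Level} (K : CommutativeRing c ℓc) (n : ℕ) where

  private module K = CommutativeRing K
  open Diagrams n

  infixl 6 _⊕_
  infixl 7 _⊗_
  infix  4 _≋_

  data TL : Set c where
    ι       : K.Carrier → TL
    t       : Fin (n ∸ 1) → TL
    _⊕_ _⊗_ : TL → TL → TL

  data _≋_ : TL → TL → Set (c ⊔ ℓc) where
    ≋-refl  : ∀ {x} → x ≋ x
    ≋-sym   : ∀ {x y} → x ≋ y → y ≋ x
    ≋-trans : ∀ {x y z} → x ≋ y → y ≋ z → x ≋ z
    ⊕-cong  : ∀ {x x′ y y′} → x ≋ x′ → y ≋ y′ → x ⊕ y ≋ x′ ⊕ y′
    ⊗-cong  : ∀ {x x′ y y′} → x ≋ x′ → y ≋ y′ → x ⊗ y ≋ x′ ⊗ y′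

    -- These give a K-algebra; negation is multiplication by ι (- 1).
    ⊕-assoc     : ∀ x y z → (x ⊕ y) ⊕ z ≋ x ⊕ (y ⊕ z)
    ⊕-comm      : ∀ x y → x ⊕ y ≋ y ⊕ x
    ⊕-identity  : ∀ x → ι K.0# ⊕ x ≋ x
    ⊗-assoc     : ∀ x y z → (x ⊗ y) ⊗ z ≋ x ⊗ (y ⊗ z)
    ⊗-identity  : ∀ x → ι K.1# ⊗ x ≋ x
    ⊗-zero      : ∀ x → ι K.0# ⊗ x ≋ ι K.0#
    ⊗-distribˡ  : ∀ x y z → x ⊗ (y ⊕ z) ≋ x ⊗ y ⊕ x ⊗ z
    ⊗-distribʳ  : ∀ x y z → (y ⊕ z) ⊗ x ≋ y ⊗ x ⊕ z ⊗ x
    ι-cong      : ∀ {a b} → a K.≈ b → ι a ≋ ι b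
    ι-+         : ∀ a b → ι (a K.+ b) ≋ ι a ⊕ ι b
    ι-*         : ∀ a b → ι (a K.* b) ≋ ι a ⊗ ι b
    ι-central   : ∀ a x → ι a ⊗ x ≋ x ⊗ ι a

    t-square  : ∀ i → t i ⊗ t i ≋ ι (K.1# K.+ K.1#) ⊗ t i
    t-braid   : ∀ i j → ℕ.∣ toℕ i - toℕ j ∣ ≡ 1 → t i ⊗ t j ⊗ t i ≋ t i
    t-commute : ∀ i j → 2 ≤ ℕ.∣ toℕ i - toℕ j ∣ → t i ⊗ t j ≋ t j ⊗ t i

  ⟦_⟧ : Word → TL
  ⟦ v ⟧ = foldr _⊗_ (ι K.1#) (map t v)

  -- A linear combination of basis elements, possibly with repetitions.
  Combination : Set c
  Combination = List (K.Carrier × BasisProduct)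

  value : Combination → TL
  value = foldr (λ (a , v) x → ι a ⊗ ⟦ word v ⟧ ⊕ x) (ι K.0#)

  coefficientIn : Matching → Combination → K.Carrier
  coefficientIn D E = foldr K._+_ K.0# (map proj₁
    (filter (λ (_ , v) → Vec.≡-dec Fin._≟_ (diagram (word v)) D) E))

  -- a is the coefficient of D in the expansion of x in the basis 𝓑ₙ.
  IsCoefficient : Matching → TL → K.Carrier → Set (c ⊔ ℓc)
  IsCoefficient D x a = ∃ λ E → x ≋ value E × a K.≈ coefficientIn D E

  -- Multiplicative maps on 𝔖ₙ are the same as algebra homomorphisms on its
  -- group algebra.  The product v w in 𝔖ₙ is v ∘ₚ w, which applies v first:
  -- this is the convention in which sᵢ w arises from the word w(1)…w(n) by
  -- exchanging its i-th and (i+1)-st letters.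
  record IsTheta (θ : Permutation′ n → TL) : Set (c ⊔ ℓc) where
    field
      θ-cong : ∀ {v w} → v Perm.≈ w → θ v ≋ θ w
      θ-id   : θ Perm.id ≋ ι K.1#
      θ-∘    : ∀ v w → θ (v ∘ₚ w) ≋ θ v ⊗ θ w
      θ-s    : ∀ i → θ (s i) ≋ t i ⊕ ι (K.- K.1#)

  record IsTLFunction (D : Matching) (f : Permutation′ n → K.Carrier) : Set (c ⊔ ℓc) where
    field
      θ           : Permutation′ n → TL
      isTheta     : IsTheta θ
      coefficient : ∀ w → IsCoefficient D (θ w) (f w)

-- With h(q,p) the product of the e_{q-p}(x⁽ʳ⁾), the Hadamard product of the
-- Jacobi–Trudi matrices of a ribbon has the entries h(N_j,N_{i-1}), hence is a
-- Hessenberg matrix with subdiagonal entries 1.  Only the permutations w_S,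
-- the increasing products of the sᵢ with i ∈ S, contribute to its immanants,
-- and w_S contributes the product of h over consecutive points of
-- {0} ∪ {Nᵢ : i ∉ S} ∪ {m}.  Since θ(w_S) is the increasing product of the
-- tᵢ - 1 over S, the coefficient of τ(I) is (-1)^|S∖I| if I ⊆ S and 0 otherwise.
-- So the points Nᵢ with i ∈ I never occur, and what remains is the expansion
-- of the determinant belonging to the ribbon with descents Nᵢ, i ∉ I.
--
-- The coefficient of a diagram is well defined because TLₙ(2) acts on
-- matchings by stacking.

module Submission where

open import Defs
open import Algebra.Bundles using (CommutativeMonoid; CommutativeRing; Semiring)
open import Algebra.Morphism.Structures using (IsRingHomomorphism)
import Algebra.Properties.CommutativeSemigroup as CommutativeSemigroupProperties
import Algebra.Properties.Monoid.Sum as MonoidSum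
open import Data.Bool.Base using (if_then_else_; _∧_; true; false)
open import Data.Empty using (⊥-elim)
open import Data.Fin.Base using (Fin; zero; suc; toℕ; fromℕ<; inject₁; _↑ˡ_; _↑ʳ_; splitAt)
import Data.Fin.Permutation as Perm
open Perm using (Permutation′; _∘ₚ_; _⟨$⟩ʳ_; _⟨$⟩ˡ_; lift₀; insert)
import Data.Fin.Properties as Fin
open import Data.Fin.Subset using (Subset; ∁; ∣_∣; _∈_; inside; outside; ⊥)
open import Data.Fin.Subset.Properties using (_∈?_; ∉⊥; x∉p⇒x∈∁p)
open import Data.Integer.Base as ℤ using (ℤ; +_; -[1+_])
import Data.Integer.Properties as ℤ
import Data.Integer.Solver as ℤSolver
open import Data.List.Base as List using (List; []; _∷_; _++_; allFin; cartesianProductWith;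
  filter; foldl; length; map)
import Data.List.Membership.Propositional as List
import Data.List.Properties as List
open import Data.List.Relation.Unary.All as All using ([]; _∷_)
open import Data.List.Relation.Unary.AllPairs using (AllPairs; []; _∷_)
open import Data.List.Relation.Unary.Any using (here; there)
open import Data.List.Relation.Unary.Linked using (Linked; []; [-]; _∷_)
open import Data.Nat.Base as ℕ using (ℕ; zero; suc; _+_; _∸_; _≤_; _<_; _≥_; z≤n; s≤s; NonZero)
import Data.Nat.Properties as ℕ
open import Data.Product.Base using (∃; _×_; _,_; proj₁; proj₂)
open import Data.Sum.Base using (_⊎_; inj₁; inj₂; [_,_]′)
open import Data.Vec.Base as Vec using ([]; _∷_; here; there; lookup)
import Data.Vec.Properties as Vec
open import Function.Base using (_∘_; id)
open import Function.Bundles using (Equivalence)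
open import Relation.Binary.Construct.Closure.Equivalence using (EqClosure)
open import Relation.Binary.Construct.Closure.ReflexiveTransitive using (_◅_) renaming (ε to empty)
open import Relation.Binary.Construct.Closure.Symmetric using (fwd; bwd)
open import Relation.Binary.PropositionalEquality as ≡
  using (_≡_; _≢_; refl; sym; trans; cong; cong₂; subst; ≢-sym; module ≡-Reasoning)
import Relation.Binary.Reasoning.Setoid as SetoidReasoning
open import Relation.Nullary using (¬_; Dec; does; yes; no)
open import Relation.Unary using (_≐_)

-- Stacking a cap, for matchings given as involutions

-- Both sides come out of one expansion. The sign of w_S is (-1)^|S|, which is the coefficient rule
-- for I = ∅, so the determinant of R_I is the case `⊥` of `Imm-chain`, and the theorem reduces to
-- the equality of two lists of points, `kept-Des`.
--
-- The obstacle lies on the algebra side. `f` is known only through some expansion of θ(w) in basis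
-- products, and multiplying out the product of the tᵢ - 1 over S gives the diagrams τ(J) of all J ⊆
-- S. Hence two facts are needed: a coefficient does not depend on the expansion, and distinct sets
-- J have distinct diagrams. For the first, x ↦ `act x (δ T) identity` respects the relations of
-- TLₙ(2) and returns the coefficient of T from every expansion. For the second, j ∈ J holds exactly
-- if the bottom point j of τ(J) is joined to a point in a column further right; this is decided
-- when the product passes the index j, and later generators leave it alone.

module Caps {v : ℕ} where

  opaque
    cap : (Fin v → Fin v) → Fin v → Fin v → Fin v → Fin v
    cap p a b q =
      if does (q Fin.≟ a) then b else
      if does (q Fin.≟ b) then a else
      if does (q Fin.≟ p a) then p b else
      if does (q Fin.≟ p b) then p a else
      p q

  record Pairing (p : Fin v → Fin v) : Set where
    field
      involutive : ∀ q → p (p q) ≡ q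
      fixfree    : ∀ q → p q ≢ q

    transposed : ∀ {q r} → p q ≡ r → p r ≡ q
    transposed {q} refl = involutive q

    injective : ∀ {q r} → p q ≡ p r → q ≡ r
    injective {q} {r} eq = trans (sym (involutive q)) (transposed (sym eq))

  data View (p : Fin v → Fin v) (a b q : Fin v) : Set where
    first  : q ≡ a → View p a b q
    second : q ≡ b → View p a b q
    toFirst  : q ≢ a → q ≢ b → p q ≡ a → View p a b q
    toSecond : q ≢ a → q ≢ b → p q ≡ b → View p a b q
    other    : q ≢ a → q ≢ b → p q ≢ a → p q ≢ b → View p a b q

  view : ∀ p a b q → View p a b q
  view p a b q with q Fin.≟ a | q Fin.≟ b | p q Fin.≟ a | p q Fin.≟ b
  ... | yes q≡a | _       | _       | _       = first q≡a
  ... | no _    | yes q≡b | _       | _       = second q≡b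
  ... | no q≢a  | no q≢b  | yes e   | _       = toFirst q≢a q≢b e
  ... | no q≢a  | no q≢b  | no _    | yes e   = toSecond q≢a q≢b e
  ... | no q≢a  | no q≢b  | no e    | no e′   = other q≢a q≢b e e′

  opaque
    unfolding cap
    cap-cong : ∀ {p p′} → (∀ q → p q ≡ p′ q) → ∀ a b q → cap p a b q ≡ cap p′ a b q
    cap-cong p≗p′ a b q rewrite p≗p′ a | p≗p′ b | p≗p′ q = refl

  opaque
    unfolding cap
    cap-first : ∀ p a b → cap p a b a ≡ b
    cap-first p a b with a Fin.≟ a
    ... | yes _ = refl
    ... | no a≢a = ⊥-elim (a≢a refl)

  opaque
    unfolding cap
    cap-second : ∀ p {a b} → a ≢ b → cap p a b b ≡ a
    cap-second p {a} {b} a≢b with b Fin.≟ a | b Fin.≟ b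
    ... | yes b≡a | _      = ⊥-elim (a≢b (sym b≡a))
    ... | no _    | yes _  = refl
    ... | no _    | no b≢b = ⊥-elim (b≢b refl)

  module _ {p : Fin v → Fin v} (pairing : Pairing p) {a b : Fin v} (a≢b : a ≢ b) where
    open Pairing pairing

    opaque
      unfolding cap
      cap-toFirst : ∀ {q} → q ≢ a → q ≢ b → p q ≡ a → cap p a b q ≡ p b
      cap-toFirst {q} q≢a q≢b pq≡a with q Fin.≟ a | q Fin.≟ b | q Fin.≟ p a
      ... | yes q≡a | _       | _      = ⊥-elim (q≢a q≡a)
      ... | no _    | yes q≡b | _      = ⊥-elim (q≢b q≡b)
      ... | no _    | no _    | yes _  = refl
      ... | no _    | no _    | no q≢pa = ⊥-elim (q≢pa (sym (transposed pq≡a)))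

    opaque
      unfolding cap
      cap-toSecond : ∀ {q} → q ≢ a → q ≢ b → p q ≡ b → cap p a b q ≡ p a
      cap-toSecond {q} q≢a q≢b pq≡b with q Fin.≟ a | q Fin.≟ b | q Fin.≟ p a | q Fin.≟ p b
      ... | yes q≡a | _       | _      | _       = ⊥-elim (q≢a q≡a)
      ... | no _    | yes q≡b | _      | _       = ⊥-elim (q≢b q≡b)
      ... | no _    | no _    | yes e  | _       = ⊥-elim (a≢b (trans (sym (transposed (sym e))) pq≡b))
      ... | no _    | no _    | no _   | yes _   = refl
      ... | no _    | no _    | no _   | no q≢pb = ⊥-elim (q≢pb (sym (transposed pq≡b)))

    opaque
      unfolding cap
      cap-other : ∀ {q} → q ≢ a → q ≢ b → p q ≢ a → p q ≢ b → cap p a b q ≡ p q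
      cap-other {q} q≢a q≢b pq≢a pq≢b with q Fin.≟ a | q Fin.≟ b | q Fin.≟ p a | q Fin.≟ p b
      ... | yes q≡a | _       | _      | _       = ⊥-elim (q≢a q≡a)
      ... | no _    | yes q≡b | _      | _       = ⊥-elim (q≢b q≡b)
      ... | no _    | no _    | yes e  | _       = ⊥-elim (pq≢a (transposed (sym e)))
      ... | no _    | no _    | no _   | yes e   = ⊥-elim (pq≢b (transposed (sym e)))
      ... | no _    | no _    | no _   | no _    = refl

    private
      b≢a : b ≢ a
      b≢a b≡a = a≢b (sym b≡a)

      cap-involutive : ∀ q → cap p a b (cap p a b q) ≡ q
      cap-involutive q with view p a b q
      ... | first refl  = trans (cong (cap p a b) (cap-first p a b)) (cap-second p a≢b)
      ... | second refl = trans (cong (cap p a b) (cap-second p a≢b)) (cap-first p a b)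
      ... | toFirst q≢a q≢b pq≡a = trans (cong (cap p a b) (cap-toFirst q≢a q≢b pq≡a))
              (trans (cap-toSecond (λ e → q≢b (trans (sym (transposed pq≡a)) (transposed e)))
                        (fixfree b) (involutive b))
                     (transposed pq≡a))
      ... | toSecond q≢a q≢b pq≡b = trans (cong (cap p a b) (cap-toSecond q≢a q≢b pq≡b))
              (trans (cap-toFirst (fixfree a)
                        (λ e → q≢a (trans (sym (transposed pq≡b)) (transposed e))) (involutive a))
                     (transposed pq≡b))
      ... | other q≢a q≢b pq≢a pq≢b = trans (cong (cap p a b) (cap-other q≢a q≢b pq≢a pq≢b))
              (trans (cap-other pq≢a pq≢b (λ e → q≢a (trans (sym (involutive q)) e))
                                          (λ e → q≢b (trans (sym (involutive q)) e)))
                     (involutive q))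

      cap-fixfree : ∀ q → cap p a b q ≢ q
      cap-fixfree q eq with view p a b q
      ... | first refl  = b≢a (trans (sym (cap-first p a b)) eq)
      ... | second refl = a≢b (trans (sym (cap-second p a≢b)) eq)
      ... | toFirst q≢a q≢b pq≡a = a≢b (trans (sym pq≡a) (transposed (trans (sym (cap-toFirst q≢a q≢b pq≡a)) eq)))
      ... | toSecond q≢a q≢b pq≡b = b≢a (trans (sym pq≡b) (transposed (trans (sym (cap-toSecond q≢a q≢b pq≡b)) eq)))
      ... | other q≢a q≢b pq≢a pq≢b = fixfree q (trans (sym (cap-other q≢a q≢b pq≢a pq≢b)) eq)

    cap-pairing : Pairing (cap p a b)
    cap-pairing = record { involutive = cap-involutive ; fixfree = cap-fixfree }

    opaque
      unfolding cap
      cap-sym : ∀ q → cap p a b q ≡ cap p b a q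
      cap-sym q with q Fin.≟ a | q Fin.≟ b | q Fin.≟ p a | q Fin.≟ p b
      ... | yes q≡a | yes q≡b | _ | _ = ⊥-elim (a≢b (trans (sym q≡a) q≡b))
      ... | yes _   | no _    | _ | _ = refl
      ... | no _    | yes _   | _ | _ = refl
      ... | no _    | no _    | yes e | yes e′ = ⊥-elim (a≢b (injective (trans (sym e) e′)))
      ... | no _    | no _    | yes _ | no _ = refl
      ... | no _    | no _    | no _  | yes _ = refl
      ... | no _    | no _    | no _  | no _ = refl

    -- A closed loop splits off and leaves no trace in the matching; it is counted by `loopFactor`
    -- alone. This is the matching half of tᵢ² = 2tᵢ.
    cap-joined : p a ≡ b → ∀ q → cap p a b q ≡ p q
    cap-joined pa≡b q with view p a b q
    ... | first refl  = trans (cap-first p a b) (sym pa≡b)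
    ... | second refl = trans (cap-second p a≢b) (sym (transposed pa≡b))
    ... | toFirst q≢a q≢b pq≡a = ⊥-elim (q≢b (trans (sym (transposed pq≡a)) pa≡b))
    ... | toSecond q≢a q≢b pq≡b = ⊥-elim (q≢a (injective (trans pq≡b (sym pa≡b))))
    ... | other q≢a q≢b pq≢a pq≢b = cap-other q≢a q≢b pq≢a pq≢b

  -- A zigzag is straightened: the first cap passes the partner of `c` on to `a`, the second hands
  -- it back to `c`. This is the matching half of tᵢtⱼtᵢ = tᵢ, where `b` is the point shared by the
  -- two generators.
  cap-cap-cap : ∀ {p a b c} → Pairing p → p a ≡ b → a ≢ b → a ≢ c → b ≢ c →
                ∀ q → cap (cap p b c) a b q ≡ p q
  cap-cap-cap {p} {a} {b} {c} pairing pa≡b a≢b a≢c b≢c q = go (view p a b q)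
    where
    open Pairing pairing
    pairing′ = cap-pairing pairing b≢c
    pb≡a = transposed pa≡b
    go : View p a b q → cap (cap p b c) a b q ≡ p q
    go (first refl)  = trans (cap-first _ a b) (sym pa≡b)
    go (second refl) = trans (cap-second _ a≢b) (sym pb≡a)
    go (toFirst q≢a q≢b pq≡a) = ⊥-elim (q≢b (injective (trans pq≡a (sym pb≡a))))
    go (toSecond q≢a q≢b pq≡b) = ⊥-elim (q≢a (injective (trans pq≡b (sym pa≡b))))
    go (other q≢a q≢b pq≢a pq≢b) with view p b c q
    ... | first q≡b = ⊥-elim (q≢b q≡b)
    ... | second refl = trans (cap-toSecond pairing′ a≢b q≢a q≢b (cap-second p b≢c))
                              (cap-toFirst pairing b≢c a≢b a≢c pa≡b)
    ... | toFirst _ _ pq≡b = ⊥-elim (pq≢b pq≡b)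
    ... | toSecond _ q≢c pq≡c = trans (cap-toFirst pairing′ a≢b q≢a q≢b
              (trans (cap-toSecond pairing b≢c q≢b q≢c pq≡c) pb≡a))
              (trans (cap-first p b c) (sym pq≡c))
    ... | other _ q≢c _ pq≢c = trans (cap-other pairing′ a≢b q≢a q≢b
              (λ e → pq≢a (trans (sym unchanged) e)) (λ e → pq≢b (trans (sym unchanged) e))) unchanged
      where unchanged = cap-other pairing b≢c q≢b q≢c pq≢b pq≢c

  record Disjoint (a b c d : Fin v) : Set where
    field
      a≢b : a ≢ b
      c≢d : c ≢ d
      a≢c : a ≢ c
      a≢d : a ≢ d
      b≢c : b ≢ c
      b≢d : b ≢ d

  flip₁ : ∀ {a b c d} → Disjoint a b c d → Disjoint b a c d
  flip₁ D = record { a≢b = ≢-sym a≢b ; c≢d = c≢d ; a≢c = b≢c ; a≢d = b≢d ; b≢c = a≢c ; b≢d = a≢d }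
    where open Disjoint D

  exchange : ∀ {a b c d} → Disjoint a b c d → Disjoint c d a b
  exchange D = record { a≢b = c≢d ; c≢d = a≢b ; a≢c = ≢-sym a≢c ; a≢d = ≢-sym b≢c ; b≢c = ≢-sym a≢d ; b≢d = ≢-sym b≢d }
    where open Disjoint D

  module _ {p : Fin v → Fin v} (pairing : Pairing p) where
    open Pairing pairing

    private
      Commutes : (a b c d q : Fin v) → Set
      Commutes a b c d q = cap (cap p a b) c d q ≡ cap (cap p c d) a b q

      commutes-at : ∀ {a b c d} → Disjoint a b c d → Commutes a b c d a
      commutes-at {a} {b} {c} {d} D =
        trans (cap-other (cap-pairing pairing a≢b) c≢d a≢c a≢d
                 (λ e → b≢c (trans (sym (cap-first p a b)) e))
                 (λ e → b≢d (trans (sym (cap-first p a b)) e)))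
              (trans (cap-first p a b) (sym (cap-first _ a b)))
        where open Disjoint D

      commutes-flip : ∀ {a b c d q} → Disjoint a b c d → Commutes b a c d q → Commutes a b c d q
      commutes-flip {a} {b} {c} {d} {q} D eq =
        trans (cap-cong (cap-sym pairing a≢b) c d q)
              (trans eq (sym (cap-sym (cap-pairing pairing c≢d) a≢b q)))
        where open Disjoint D

      -- The case in which the caps interact: `q` is passed on to `p b`, which may itself be `c` or
      -- `d` and then passes `q` on once more. Both sides are brought to `cap p c d b`, the left one
      -- by `byPartner`.
      commutes-toFirst : ∀ {a b c d q} → Disjoint a b c d → q ≢ a → q ≢ b → p q ≡ a → Commutes a b c d q
      commutes-toFirst {a} {b} {c} {d} {q} D q≢a q≢b pq≡a = dispatch (q Fin.≟ c) (q Fin.≟ d)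
        where
        open Disjoint D
        pairing₁ = cap-pairing pairing a≢b
        pairing₂ = cap-pairing pairing c≢d
        left : cap p a b q ≡ p b
        left = cap-toFirst pairing a≢b q≢a q≢b pq≡a
        unmoved : ∀ {r} → r ≢ q → r ≢ a → r ≢ b → p r ≢ b → cap p a b r ≡ p r
        unmoved r≢q r≢a r≢b pr≢b = cap-other pairing a≢b r≢a r≢b
          (λ e → r≢q (injective (trans e (sym pq≡a)))) pr≢b
        byPartner : q ≢ c → q ≢ d → Dec (p b ≡ c) → Dec (p b ≡ d) → cap (cap p a b) c d q ≡ cap p c d b
        byPartner q≢c q≢d (yes pb≡c) _ =
          trans (cap-toFirst pairing₁ c≢d q≢c q≢d (trans left pb≡c))
          (trans (unmoved (≢-sym q≢d) (≢-sym a≢d) (≢-sym b≢d)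
                    (λ e → c≢d (trans (sym pb≡c) (transposed e))))
                 (sym (cap-toFirst pairing c≢d b≢c b≢d pb≡c)))
        byPartner q≢c q≢d (no _) (yes pb≡d) =
          trans (cap-toSecond pairing₁ c≢d q≢c q≢d (trans left pb≡d))
          (trans (unmoved (≢-sym q≢c) (≢-sym a≢c) (≢-sym b≢c)
                    (λ e → c≢d (trans (sym (transposed e)) pb≡d)))
                 (sym (cap-toSecond pairing c≢d b≢c b≢d pb≡d)))
        byPartner q≢c q≢d (no pb≢c) (no pb≢d) =
          trans (cap-other pairing₁ c≢d q≢c q≢d (λ e → pb≢c (trans (sym left) e))
                                                (λ e → pb≢d (trans (sym left) e)))
          (trans left (sym (cap-other pairing c≢d b≢c b≢d pb≢c pb≢d)))
        dispatch : Dec (q ≡ c) → Dec (q ≡ d) → Commutes a b c d q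
        dispatch (yes refl) _ = sym (commutes-at (exchange D))
        dispatch (no _) (yes refl) =
          sym (commutes-flip (exchange D) (commutes-at (flip₁ (exchange D))))
        dispatch (no q≢c) (no q≢d) = trans (byPartner q≢c q≢d (p b Fin.≟ c) (p b Fin.≟ d))
          (sym (cap-toFirst pairing₂ a≢b q≢a q≢b
            (trans (cap-other pairing c≢d q≢c q≢d (λ e → a≢c (trans (sym pq≡a) e))
                                                  (λ e → a≢d (trans (sym pq≡a) e))) pq≡a)))

      commutes-onto : ∀ {a b c d q} → Disjoint a b c d → View p a b q →
                      (q ≢ a → q ≢ b → p q ≢ a → p q ≢ b → Commutes a b c d q) → Commutes a b c d q
      commutes-onto D (first refl) _ = commutes-at D
      commutes-onto D (second refl) _ = commutes-flip D (commutes-at (flip₁ D))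
      commutes-onto D (toFirst q≢a q≢b pq≡a) _ = commutes-toFirst D q≢a q≢b pq≡a
      commutes-onto D (toSecond q≢a q≢b pq≡b) _ =
        commutes-flip D (commutes-toFirst (flip₁ D) q≢b q≢a pq≡b)
      commutes-onto D (other q≢a q≢b pq≢a pq≢b) k = k q≢a q≢b pq≢a pq≢b

    -- Points that belong to {a, b} or are joined to it are settled first; the same argument with
    -- the pairs exchanged settles those at {c, d}. Every remaining point keeps its partner in
    -- either order.
    cap-commute : ∀ {a b c d} → Disjoint a b c d → ∀ q →
                  cap (cap p a b) c d q ≡ cap (cap p c d) a b q
    cap-commute {a} {b} {c} {d} D q =
      commutes-onto D (view p a b q) λ q≢a q≢b pq≢a pq≢b →
      sym (commutes-onto (exchange D) (view p c d q) λ q≢c q≢d pq≢c pq≢d →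
      trans (unchanged₂ c≢d a≢b q≢c q≢d pq≢c pq≢d q≢a q≢b pq≢a pq≢b)
            (sym (unchanged₂ a≢b c≢d q≢a q≢b pq≢a pq≢b q≢c q≢d pq≢c pq≢d)))
      where
      open Disjoint D
      unchanged₂ : ∀ {a b c d} → a ≢ b → c ≢ d → q ≢ a → q ≢ b → p q ≢ a → p q ≢ b →
                   q ≢ c → q ≢ d → p q ≢ c → p q ≢ d → cap (cap p a b) c d q ≡ p q
      unchanged₂ a≢b c≢d q≢a q≢b pq≢a pq≢b q≢c q≢d pq≢c pq≢d =
        trans (cap-other (cap-pairing pairing a≢b) c≢d q≢c q≢d (λ e → pq≢c (trans (sym same) e))
                                                                (λ e → pq≢d (trans (sym same) e))) same
        where same = cap-other pairing a≢b q≢a q≢b pq≢a pq≢b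

    cap-joins : ∀ {a b c d} → Disjoint a b c d → p a ≡ b → cap p c d a ≡ b
    cap-joins D pa≡b = trans (cap-other pairing c≢d a≢c a≢d (λ e → b≢c (trans (sym pa≡b) e))
                                                             (λ e → b≢d (trans (sym pa≡b) e))) pa≡b
      where open Disjoint D

    cap-joins⁻¹ : ∀ {a b c d} → Disjoint a b c d → p a ≡ b → cap p a b c ≡ d → p c ≡ d
    cap-joins⁻¹ {a} {b} {c} {d} D pa≡b eq =
      trans (sym (cap-joined pairing (Disjoint.a≢b D) pa≡b c)) eq

    -- If `c` and `d` become joined only through the cap at `a`, `b`, then two arcs of `p` connect
    -- {a, b} with {c, d} and form one loop with the two caps. Whichever cap comes second closes it,
    -- so both orders count one loop.
    cap-joins-exchange : ∀ {a b c d} → Disjoint a b c d → p c ≢ d → cap p a b c ≡ d → cap p c d a ≡ b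
    cap-joins-exchange {a} {b} {c} {d} D pc≢d eq with view p a b c
    ... | first c≡a = ⊥-elim (Disjoint.a≢c D (sym c≡a))
    ... | second c≡b = ⊥-elim (Disjoint.b≢c D (sym c≡b))
    ... | toFirst c≢a c≢b pc≡a =
          trans (cap-toFirst pairing (Disjoint.c≢d D) (Disjoint.a≢c D) (Disjoint.a≢d D) (transposed pc≡a))
                (transposed (trans (sym (cap-toFirst pairing (Disjoint.a≢b D) c≢a c≢b pc≡a)) eq))
    ... | toSecond c≢a c≢b pc≡b =
          trans (cap-toSecond pairing (Disjoint.c≢d D) (Disjoint.a≢c D) (Disjoint.a≢d D)
                  (trans (sym (cap-toSecond pairing (Disjoint.a≢b D) c≢a c≢b pc≡b)) eq)) pc≡b
    ... | other c≢a c≢b pc≢a pc≢b =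
          ⊥-elim (pc≢d (trans (sym (cap-other pairing (Disjoint.a≢b D) c≢a c≢b pc≢a pc≢b)) eq))

-- Kauffman diagrams

toℕ-lo : ∀ n (i : Fin (n ∸ 1)) → toℕ (lo {n} i) ≡ toℕ i
toℕ-lo (suc n) i = Fin.toℕ-inject₁ i

toℕ-hi : ∀ n (i : Fin (n ∸ 1)) → toℕ (hi {n} i) ≡ suc (toℕ i)
toℕ-hi (suc n) i = refl

∣m-n∣≡1⇒adjacent : ∀ m n → ℕ.∣ m - n ∣ ≡ 1 → suc m ≡ n ⊎ m ≡ suc n
∣m-n∣≡1⇒adjacent zero    (suc n) eq = inj₁ (sym eq)
∣m-n∣≡1⇒adjacent (suc m) zero    eq = inj₂ eq
∣m-n∣≡1⇒adjacent (suc m) (suc n) eq with ∣m-n∣≡1⇒adjacent m n eq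
... | inj₁ e = inj₁ (cong suc e)
... | inj₂ e = inj₂ (cong suc e)

∣1+n-n∣≡1 : ∀ n → ℕ.∣ suc n - n ∣ ≡ 1
∣1+n-n∣≡1 zero    = refl
∣1+n-n∣≡1 (suc n) = ∣1+n-n∣≡1 n

module Stacking (n : ℕ) where
  open Caps
  open Diagrams n

  loₙ hiₙ : Fin (n ∸ 1) → Fin n
  loₙ = lo
  hiₙ = hi

  opaque
    partner : Matching → Fin (n + n) → Fin (n + n)
    partner = lookup

  Closes : Fin (n ∸ 1) → Matching → Set
  Closes i D = partner D (bottomLo i) ≡ bottomHi i

  opaque
    unfolding partner
    closes≡closesLoop : ∀ i D → Closes i D ≡ closesLoop i D
    closes≡closesLoop i D = refl

  Paired : Matching → Set
  Paired D = Pairing (partner D)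

  opaque
    unfolding partner cap

    partner-injective : ∀ {D D′ : Matching} → (∀ q → partner D q ≡ partner D′ q) → D ≡ D′
    partner-injective {D} {D′} eq =
      trans (sym (Vec.tabulate∘lookup D)) (trans (Vec.tabulate-cong eq) (Vec.tabulate∘lookup D′))

    partner-stack : ∀ D i q → partner (stack D i) q ≡ cap (partner D) (bottomLo i) (bottomHi i) q
    partner-stack D i q = Vec.lookup∘tabulate _ q

    partner-identity : ∀ q → partner identity q ≡ [ n ↑ʳ_ , _↑ˡ n ]′ (splitAt n q)
    partner-identity q = Vec.lookup∘tabulate _ q

  bottom-injective : ∀ {i j : Fin n} → n ↑ʳ i ≡ n ↑ʳ j → toℕ i ≡ toℕ j
  bottom-injective {i} {j} eq = cong toℕ (Fin.↑ʳ-injective n i j eq)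

  top≢bottom : ∀ {i j : Fin n} → i ↑ˡ n ≢ n ↑ʳ j
  top≢bottom {i} {j} eq with trans (sym (Fin.splitAt-↑ˡ n i n)) (trans (cong (splitAt n) eq) (Fin.splitAt-↑ʳ n n j))
  ... | ()

  lo≢lo : ∀ {i j : Fin (n ∸ 1)} → toℕ i ≢ toℕ j → bottomLo i ≢ bottomLo j
  lo≢lo {i} {j} i≢j eq = i≢j (trans (sym (toℕ-lo n i)) (trans (bottom-injective eq) (toℕ-lo n j)))

  lo≢hi′ : ∀ {i j : Fin (n ∸ 1)} → toℕ i ≢ suc (toℕ j) → bottomLo i ≢ bottomHi j
  lo≢hi′ {i} {j} i≢j eq = i≢j (trans (sym (toℕ-lo n i)) (trans (bottom-injective eq) (toℕ-hi n j)))

  hi≢hi : ∀ {i j : Fin (n ∸ 1)} → toℕ i ≢ toℕ j → bottomHi i ≢ bottomHi j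
  hi≢hi {i} {j} i≢j eq = i≢j (ℕ.suc-injective (trans (sym (toℕ-hi n i)) (trans (bottom-injective eq) (toℕ-hi n j))))

  lo≢hi : ∀ i → bottomLo i ≢ bottomHi i
  lo≢hi i = lo≢hi′ {i} {i} (λ eq → ℕ.1+n≢n (sym eq))

  hi≡lo : ∀ {i j : Fin (n ∸ 1)} → suc (toℕ i) ≡ toℕ j → bottomHi i ≡ bottomLo j
  hi≡lo {i} {j} eq = cong (n ↑ʳ_) (Fin.toℕ-injective (trans (toℕ-hi n i) (trans eq (sym (toℕ-lo n j)))))

  pairing-cong : ∀ {p p′ : Fin (n + n) → Fin (n + n)} → (∀ q → p′ q ≡ p q) → Pairing p → Pairing p′
  pairing-cong {p} {p′} eq P = record
    { involutive = λ q → trans (eq (p′ q)) (trans (cong p (eq q)) (involutive q))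
    ; fixfree    = λ q e → fixfree q (trans (sym (eq q)) e)
    }
    where open Pairing P

  stack-paired : ∀ {D} → Paired D → ∀ i → Paired (stack D i)
  stack-paired P i = pairing-cong (partner-stack _ i) (cap-pairing P (lo≢hi i))

  stack-closes : ∀ D i → Closes i (stack D i)
  stack-closes D i = trans (partner-stack D i (bottomLo i)) (cap-first (partner D) _ _)

  stack-idempotent : ∀ {D} → Paired D → ∀ i → stack (stack D i) i ≡ stack D i
  stack-idempotent {D} P i = partner-injective λ q →
    trans (partner-stack _ i q) (cap-joined (stack-paired P i) (lo≢hi i) (stack-closes D i) q)

  record Braids (D : Matching) (i j : Fin (n ∸ 1)) : Set where
    field
      noLoop₁  : ¬ Closes j (stack D i)
      noLoop₂  : ¬ Closes i (stack (stack D i) j)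
      restores : stack (stack (stack D i) j) i ≡ stack D i

  -- `cap-cap-cap` applies to `stack D i`, where the two points of tᵢ are joined. Its middle point
  -- `b` must be the one shared with tⱼ: the right point of tᵢ if j = i + 1, the left one if j = i -
  -- 1. In the second case the caps are reversed by `cap-sym` first.
  stack-braid : ∀ {D} → Paired D → ∀ i j → ℕ.∣ toℕ i - toℕ j ∣ ≡ 1 → Braids D i j
  stack-braid {D} P i j adjacent with ∣m-n∣≡1⇒adjacent (toℕ i) (toℕ j) adjacent
  ... | inj₁ 1+i≡j = record
    { noLoop₁  = λ e → lo≢hi-ij (trans (sym joined′) (trans (cong p hi≡) e))
    ; noLoop₂  = λ e → lo≢hi-ij (trans (sym joined′) (transposed
        (trans (sym (trans (partner-stack _ j _) (trans (cong (λ x → cap p x _ _) (sym hi≡))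
        (cap-toFirst P₁ hi≢hi-ij (lo≢hi i) lo≢hi-ij joined)))) e)))
    ; restores = partner-injective λ q → trans (partner-stack _ i q)
        (trans (cap-cong (λ r → trans (partner-stack _ j r) (cong (λ x → cap p x _ r) (sym hi≡))) _ _ q)
               (cap-cap-cap P₁ joined (lo≢hi i) lo≢hi-ij hi≢hi-ij q))
    }
    where
    P₁ = stack-paired P i
    open Pairing P₁
    p = partner (stack D i)
    joined = stack-closes D i
    joined′ = transposed joined
    hi≡ = hi≡lo {i} {j} 1+i≡j
    hi≢hi-ij : bottomHi i ≢ bottomHi j
    hi≢hi-ij = hi≢hi λ e → ℕ.1+n≢n (trans 1+i≡j (sym e))
    lo≢hi-ij : bottomLo i ≢ bottomHi j
    lo≢hi-ij = lo≢hi′ {i} {j} λ e → ℕ.m≢1+m+n _ (trans e (cong suc (trans (sym 1+i≡j) (sym (ℕ.+-comm (toℕ i) 1)))))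
  ... | inj₂ i≡1+j = record
    { noLoop₁  = λ e → lo≢hi-ji (trans (sym (transposed (trans e hi≡))) joined)
    ; noLoop₂  = λ e → lo≢hi-ji (trans (sym (trans (partner-stack _ j _)
        (trans (cong (cap p _ _) (sym hi≡)) (cap-second p (lo≢hi j))))) e)
    ; restores = partner-injective λ q → trans (partner-stack _ i q)
        (trans (cap-sym (stack-paired P₁ j) (lo≢hi i) q)
        (trans (cap-cong (λ r → trans (partner-stack _ j r)
                         (trans (cap-sym P₁ (lo≢hi j) r) (cong (λ x → cap p x _ r) hi≡))) _ _ q)
               (cap-cap-cap P₁ (transposed joined) (≢-sym (lo≢hi i)) (≢-sym lo≢hi-ji) lo≢lo-ij q)))
    }
    where
    P₁ = stack-paired P i
    open Pairing P₁
    p = partner (stack D i)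
    joined = stack-closes D i
    hi≡ = hi≡lo {j} {i} (sym i≡1+j)
    lo≢lo-ij : bottomLo i ≢ bottomLo j
    lo≢lo-ij = lo≢lo λ e → ℕ.1+n≢n (trans (sym i≡1+j) e)
    lo≢hi-ji : bottomLo j ≢ bottomHi i
    lo≢hi-ji = lo≢hi′ {j} {i} λ e → ℕ.m≢1+m+n _ (trans e (cong suc (trans i≡1+j (sym (ℕ.+-comm (toℕ j) 1)))))

  disjoint : ∀ {i j : Fin (n ∸ 1)} → 2 ≤ ℕ.∣ toℕ i - toℕ j ∣ →
             Disjoint (bottomLo i) (bottomHi i) (bottomLo j) (bottomHi j)
  disjoint {i} {j} 2≤ = record
    { a≢b = lo≢hi i ; c≢d = lo≢hi j ; a≢c = lo≢lo i≢j ; b≢d = hi≢hi i≢j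
    ; a≢d = lo≢hi′ {i} {j} λ e → 2≰1 (subst (2 ≤_) (trans (cong (λ x → ℕ.∣ x - toℕ j ∣) e) (∣1+n-n∣≡1 (toℕ j))) 2≤)
    ; b≢c = ≢-sym (lo≢hi′ {j} {i} λ e → 2≰1 (subst (2 ≤_)
        (trans (ℕ.∣-∣-comm (toℕ i) (toℕ j)) (trans (cong (λ x → ℕ.∣ x - toℕ i ∣) e) (∣1+n-n∣≡1 (toℕ i)))) 2≤))
    }
    where
    2≰1 : ¬ 2 ≤ 1
    2≰1 (s≤s ())
    i≢j : toℕ i ≢ toℕ j
    i≢j e with subst (2 ≤_) (ℕ.m≡n⇒∣m-n∣≡0 e) 2≤
    ... | ()

  stack-commute : ∀ {D} → Paired D → ∀ i j → 2 ≤ ℕ.∣ toℕ i - toℕ j ∣ →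
                  stack (stack D i) j ≡ stack (stack D j) i
  stack-commute P i j 2≤ = partner-injective λ q →
    trans (partner-stack _ j q) (trans (cap-cong (partner-stack _ i) _ _ q)
    (trans (cap-commute P (disjoint 2≤) q)
    (sym (trans (partner-stack _ i q) (cap-cong (partner-stack _ j) _ _ q)))))

  stack-keepsLoop : ∀ {D} → Paired D → ∀ i j → 2 ≤ ℕ.∣ toℕ i - toℕ j ∣ →
                    Closes i D → Closes i (stack D j)
  stack-keepsLoop P i j 2≤ loop = trans (partner-stack _ j _) (cap-joins P (disjoint 2≤) loop)

  stack-keepsLoop⁻¹ : ∀ {D} → Paired D → ∀ i j → 2 ≤ ℕ.∣ toℕ i - toℕ j ∣ →
                      Closes i D → Closes j (stack D i) → Closes j D
  stack-keepsLoop⁻¹ P i j 2≤ loop e = cap-joins⁻¹ P (disjoint 2≤) loop (trans (sym (partner-stack _ i _)) e)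

  stack-exchangesLoop : ∀ {D} → Paired D → ∀ i j → 2 ≤ ℕ.∣ toℕ i - toℕ j ∣ →
                        ¬ Closes j D → Closes j (stack D i) → Closes i (stack D j)
  stack-exchangesLoop P i j 2≤ ¬loop e = trans (partner-stack _ j _)
    (cap-joins-exchange P (disjoint 2≤) ¬loop (trans (sym (partner-stack _ i _)) e))

  -- Recovering a subset from the diagram of its increasing product

  column : Fin (n + n) → ℕ
  column q = [ toℕ , toℕ ]′ (splitAt n q)

  column-top : ∀ (j : Fin n) → column (j ↑ˡ n) ≡ toℕ j
  column-top j = cong [ toℕ , toℕ ]′ (Fin.splitAt-↑ˡ n j n)

  column-bottom : ∀ (j : Fin n) → column (n ↑ʳ j) ≡ toℕ j
  column-bottom j = cong [ toℕ , toℕ ]′ (Fin.splitAt-↑ʳ n n j)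

  -- Holds for the products in increasing order of distinct tⱼ with j < o.
  record Below (o : ℕ) (D : Matching) : Set where
    field
      paired   : Paired D
      straight : ∀ j → o < toℕ j → partner D (n ↑ʳ j) ≡ j ↑ˡ n
      leftward : ∀ j → toℕ j ≡ o → column (partner D (n ↑ʳ j)) ≤ o

  -- For D = τ(I) this means j ∉ I, so I can be read off from τ(I).
  Leftward : Fin (n ∸ 1) → Matching → Set
  Leftward j D = column (partner D (bottomLo j)) ≤ toℕ j

  below-identity : Below 0 identity
  below-identity = record
    { paired = record { involutive = involutive ; fixfree = fixfree }
    ; straight = λ j _ → bottom j
    ; leftward = λ j j≡0 → ℕ.≤-reflexive (trans (cong column (bottom j)) (trans (column-top j) j≡0))
    }
    where
    top : ∀ j → partner identity (j ↑ˡ n) ≡ n ↑ʳ j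
    top j = trans (partner-identity (j ↑ˡ n)) (cong [ n ↑ʳ_ , _↑ˡ n ]′ (Fin.splitAt-↑ˡ n j n))
    bottom : ∀ j → partner identity (n ↑ʳ j) ≡ j ↑ˡ n
    bottom j = trans (partner-identity (n ↑ʳ j)) (cong [ n ↑ʳ_ , _↑ˡ n ]′ (Fin.splitAt-↑ʳ n n j))
    involutive : ∀ q → partner identity (partner identity q) ≡ q
    involutive q with splitAt n q in eq
    ... | inj₁ j rewrite sym (Fin.splitAt⁻¹-↑ˡ eq) | top j = bottom j
    ... | inj₂ j rewrite sym (Fin.splitAt⁻¹-↑ʳ {n} eq) | bottom j = top j
    fixfree : ∀ q → partner identity q ≢ q
    fixfree q e with splitAt n q in eq
    ... | inj₁ j rewrite sym (Fin.splitAt⁻¹-↑ˡ eq) = top≢bottom (trans (sym e) (top j))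
    ... | inj₂ j rewrite sym (Fin.splitAt⁻¹-↑ʳ {n} eq) = top≢bottom (trans (sym (bottom j)) e)

  below-skip : ∀ {o D} → Below o D → Below (suc o) D
  below-skip {o} {D} B = record
    { paired   = paired
    ; straight = λ j o<j → straight j (ℕ.<-trans (ℕ.n<1+n o) o<j)
    ; leftward = λ j j≡1+o → ℕ.≤-reflexive
        (trans (cong column (straight j (ℕ.≤-reflexive (sym j≡1+o)))) (trans (column-top j) j≡1+o))
    }
    where open Below B

  module _ {D : Matching} (i : Fin (n ∸ 1)) (B : Below (toℕ i) D) where
    open Below B
    open Pairing paired

    leftward-skip : Leftward i D
    leftward-skip = leftward (loₙ i) (toℕ-lo n i)

    hi-top : partner D (bottomHi i) ≡ hiₙ i ↑ˡ n
    hi-top = straight (hiₙ i) (ℕ.≤-reflexive (sym (toℕ-hi n i)))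

    -- The partner of the bottom point i lies in a column ≤ i, whereas `bottomHi i` lies in column i
    -- + 1. Hence increasing products of distinct generators never pick up a factor 2.
    below-noLoop : ¬ Closes i D
    below-noLoop loop = ℕ.<-irrefl refl (ℕ.≤-trans (ℕ.≤-reflexive
      (trans (sym (toℕ-hi n i)) (trans (sym (column-bottom (hiₙ i))) (cong column (sym loop))))) leftward-skip)

    leftward-stack : ¬ Leftward i (stack D i)
    leftward-stack l = ℕ.<-irrefl refl (ℕ.≤-trans (ℕ.≤-reflexive
      (trans (sym (toℕ-hi n i)) (trans (sym (column-bottom (hiₙ i))) (cong column (sym (stack-closes D i)))))) l)

    below-stack : Below (suc (toℕ i)) (stack D i)
    below-stack = record
      { paired   = stack-paired paired i
      ; straight = straight′
      ; leftward = λ j j≡1+i → ℕ.≤-trans (ℕ.≤-reflexive (trans (cong column (atHi j j≡1+i))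
          (trans (column-bottom (loₙ i)) (toℕ-lo n i)))) (ℕ.n≤1+n _)
      }
      where
      atHi : ∀ j → toℕ j ≡ suc (toℕ i) → partner (stack D i) (n ↑ʳ j) ≡ bottomLo i
      atHi j j≡1+i = trans (cong (partner (stack D i)) (cong (n ↑ʳ_) (Fin.toℕ-injective (trans j≡1+i (sym (toℕ-hi n i))))))
        (trans (partner-stack D i _) (cap-second (partner D) (lo≢hi i)))
      straight′ : ∀ j → suc (toℕ i) < toℕ j → partner (stack D i) (n ↑ʳ j) ≡ j ↑ˡ n
      straight′ j 1+i<j = trans (partner-stack D i _) (trans (cap-other paired (lo≢hi i)
        (λ e → ℕ.<⇒≢ (ℕ.<-trans (ℕ.n<1+n _) 1+i<j) (trans (sym (toℕ-lo n i)) (sym (bottom-injective e))))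
        (λ e → ℕ.<⇒≢ 1+i<j (trans (sym (toℕ-hi n i)) (sym (bottom-injective e))))
        (λ e → top≢bottom (trans (sym old) e))
        (λ e → top≢bottom (trans (sym old) e))) old)
        where old = straight j (ℕ.<-trans (ℕ.n<1+n _) 1+i<j)

    -- The partner of the bottom point j changes only if it was the left point of tᵢ. It then
    -- becomes the top point of column i + 1, because `bottomHi i` is still joined straight upwards.
    -- Columns i and i + 1 are both to the right of j, so the answer stays the same.
    leftward-persists : ∀ j → toℕ j < toℕ i →
                        (Leftward j (stack D i) → Leftward j D) × (Leftward j D → Leftward j (stack D i))
    leftward-persists j j<i = go (view (partner D) (bottomLo i) (bottomHi i) (bottomLo j))
      where
      j<1+i = ℕ.<-trans j<i (ℕ.n<1+n _)
      rightward : ∀ {E : Matching} {k} → column (partner E (bottomLo j)) ≡ k → toℕ j < k → ¬ Leftward j E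
      rightward e j<k l = ℕ.<-irrefl refl (ℕ.<-≤-trans j<k (ℕ.≤-trans (ℕ.≤-reflexive (sym e)) l))
      go : View (partner D) (bottomLo i) (bottomHi i) (bottomLo j) → _
      go (first e) = ⊥-elim (lo≢lo (ℕ.<⇒≢ j<i) e)
      go (second e) = ⊥-elim (lo≢hi′ {j} {i} (ℕ.<⇒≢ j<1+i) e)
      go (toFirst j≢lo j≢hi e) =
        (λ l → ⊥-elim (rightward {stack D i} (trans (cong column (trans (partner-stack D i _)
                 (trans (cap-toFirst paired (lo≢hi i) j≢lo j≢hi e) hi-top)))
                 (trans (column-top (hiₙ i)) (toℕ-hi n i))) j<1+i l)) ,
        (λ l → ⊥-elim (rightward {D} (trans (cong column e) (trans (column-bottom (loₙ i)) (toℕ-lo n i))) j<i l))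
      go (toSecond _ _ e) = ⊥-elim (top≢bottom (trans (sym hi-top) (transposed e)))
      go (other j≢lo j≢hi e e′) = subst (λ q → column q ≤ toℕ j) same , subst (λ q → column q ≤ toℕ j) (sym same)
        where same = trans (partner-stack D i _) (cap-other paired (lo≢hi i) j≢lo j≢hi e e′)

  run : ∀ {r} → Matching → Subset r → (Fin r → Fin (n ∸ 1)) → Matching
  run D []            ε = D
  run D (inside  ∷ I) ε = run (stack D (ε zero)) I (ε ∘ suc)
  run D (outside ∷ I) ε = run D I (ε ∘ suc)

  run-filter : ∀ {r} (D : Matching) (J : Subset (n ∸ 1)) (I : Subset r) (ε : Fin r → Fin (n ∸ 1)) →
               (∀ j → lookup J (ε j) ≡ lookup I j) →
               foldl stack D (filter (_∈? J) (List.tabulate ε)) ≡ run D I ε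
  run-filter D J []            ε _ = refl
  run-filter D J (inside  ∷ I) ε agree =
    trans (cong (foldl stack D) (List.filter-accept (_∈? J) (Vec.lookup⇒[]= (ε zero) J (agree zero))))
          (run-filter (stack D (ε zero)) J I (ε ∘ suc) (agree ∘ suc))
  run-filter D J (outside ∷ I) ε agree =
    trans (cong (foldl stack D) (List.filter-reject (_∈? J) ε0∉J))
          (run-filter D J I (ε ∘ suc) (agree ∘ suc))
    where
    ε0∉J : ¬ (ε zero ∈ J)
    ε0∉J ε0∈J with trans (sym (agree zero)) (Vec.[]=⇒lookup ε0∈J)
    ... | ()

  τ≡run : ∀ I → τ I ≡ run identity I id
  τ≡run I = run-filter identity I I id (λ _ → refl)

  infix 4 _≡_+offset
  -- Recursion on a subset shortens it from the front, while generators keep their absolute indices.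
  -- `ε` therefore names the generators o, o + 1, ... that belong to the remaining positions, and
  -- `Below o` describes the part already drawn.
  _≡_+offset : ∀ {r} → (Fin r → Fin (n ∸ 1)) → ℕ → Set
  ε ≡ o +offset = ∀ j → toℕ (ε j) ≡ o + toℕ j

  offset-zero : ∀ {r o} {ε : Fin (suc r) → Fin (n ∸ 1)} → ε ≡ o +offset → toℕ (ε zero) ≡ o
  offset-zero {o = o} off = trans (off zero) (ℕ.+-identityʳ o)

  offset-suc : ∀ {r o} {ε : Fin (suc r) → Fin (n ∸ 1)} → ε ≡ o +offset → (ε ∘ suc) ≡ suc o +offset
  offset-suc {o = o} off j = trans (off (suc j)) (ℕ.+-suc o (toℕ j))

  Agree : Fin (n ∸ 1) → Matching → Matching → Set
  Agree j D E = (Leftward j D → Leftward j E) × (Leftward j E → Leftward j D)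

  agree-trans : ∀ {j D E F} → Agree j D E → Agree j E F → Agree j D F
  agree-trans (f , g) (f′ , g′) = f′ ∘ f , g ∘ g′

  -- All generators still to come have index at least `o`, so `leftward-persists` applies to each of
  -- them. What the diagram says about indices below `o` is final.
  run-agree : ∀ {r o D} (I : Subset r) {ε} → ε ≡ o +offset → Below o D →
              ∀ j → toℕ j < o → Agree j (run D I ε) D
  run-agree []            off B j j<o = id , id
  run-agree (outside ∷ I) off B j j<o = run-agree I (offset-suc off) (below-skip B) j (ℕ.<-trans j<o (ℕ.n<1+n _))
  run-agree {o = o} {D} (inside  ∷ I) {ε} off B j j<o with offset-zero off
  ... | refl = agree-trans {E = stack D (ε zero)}
    (run-agree I (offset-suc off) (below-stack (ε zero) B) j (ℕ.<-trans j<o (ℕ.n<1+n _)))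
    (leftward-persists (ε zero) B j j<o)

-- Coefficients in TLₙ(2)

module SubsetWeights {c ℓc} (K : CommutativeRing c ℓc) where
  open CommutativeRing K

  weight : ∀ {r} → Subset r → Subset r → Carrier
  weight []            []            = 1#
  weight (inside  ∷ I) (inside  ∷ S) = weight I S
  weight (inside  ∷ I) (outside ∷ S) = 0#
  weight (outside ∷ I) (inside  ∷ S) = - 1# * weight I S
  weight (outside ∷ I) (outside ∷ S) = weight I S

-- These are the permutations w with w(i) ≥ i - 1 for all i, the only ones
-- that contribute to an immanant of a Hessenberg matrix.
hessenberg : ∀ {n r} → Subset r → Permutation′ (suc n)
hessenberg {n}     []            = Perm.id
hessenberg {zero}  (_       ∷ S) = Perm.id
hessenberg {suc n} (inside  ∷ S) = s zero ∘ₚ lift₀ (hessenberg {n} S)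
hessenberg {suc n} (outside ∷ S) = lift₀ (hessenberg {n} S)

product-s : ∀ n {r} → Subset r → (Fin r → Fin (n ∸ 1)) → Permutation′ n
product-s n []            ε = Perm.id
product-s n (inside  ∷ S) ε = s (ε zero) ∘ₚ product-s n S (ε ∘ suc)
product-s n (outside ∷ S) ε = product-s n S (ε ∘ suc)

lift₀-product-s : ∀ {n r} (S : Subset r) (ε : Fin r → Fin n) →
                  lift₀ (product-s (suc n) S ε) Perm.≈ product-s (suc (suc n)) S (suc ∘ ε)
lift₀-product-s []            ε i = Perm.lift₀-id i
lift₀-product-s {n} (inside  ∷ S) ε i =
  trans (sym (Perm.lift₀-comp (s (ε zero)) (product-s (suc n) S (ε ∘ suc)) i))
  (trans (cong (lift₀ (product-s (suc n) S (ε ∘ suc)) ⟨$⟩ʳ_)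
                 (sym (Perm.lift₀-transpose (inject₁ (ε zero)) (suc (ε zero)) i)))
           (lift₀-product-s S (ε ∘ suc) _))
lift₀-product-s (outside ∷ S) ε i = lift₀-product-s S (ε ∘ suc) i

-- The recursive form fits the expansion of an immanant along the first column; the product form is
-- the one on which multiplicativity of θ can be used.
hessenberg≈product-s : ∀ {n} (S : Subset n) → hessenberg S Perm.≈ product-s (suc n) S id
hessenberg≈product-s         []            i = refl
hessenberg≈product-s {suc n} (inside  ∷ S) i =
  trans (Perm.lift₀-cong _ _ (hessenberg≈product-s S) _) (lift₀-product-s S id _)
hessenberg≈product-s {suc n} (outside ∷ S) i =
  trans (Perm.lift₀-cong _ _ (hessenberg≈product-s S) i) (lift₀-product-s S id i)

module Coefficients {c ℓc} (K : CommutativeRing c ℓc) (n : ℕ) where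

  open CommutativeRing K hiding (zero)
    renaming (Carrier to |K|; _+_ to _+ᴷ_; refl to ≈-refl; sym to ≈-sym; trans to ≈-trans)
  open Diagrams n
  open Stacking n
  open TemperleyLieb K n
  open SubsetWeights K
  open SetoidReasoning setoid
  open CommutativeSemigroupProperties *-commutativeSemigroup using (x∙yz≈y∙xz)
  open CommutativeSemigroupProperties (CommutativeMonoid.commutativeSemigroup +-commutativeMonoid)
    using (interchange)

  loopFactor : Matching → Fin (n ∸ 1) → |K|
  loopFactor D i = if does (partner D (bottomLo i) Fin.≟ bottomHi i) then 1# +ᴷ 1# else 1#

  loopFactor-loop : ∀ {D i} → Closes i D → loopFactor D i ≡ 1# +ᴷ 1#
  loopFactor-loop {D} {i} loop with partner D (bottomLo i) Fin.≟ bottomHi i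
  ... | yes _    = refl
  ... | no ¬loop = ⊥-elim (¬loop loop)

  loopFactor-noLoop : ∀ {D i} → ¬ Closes i D → loopFactor D i ≡ 1#
  loopFactor-noLoop {D} {i} ¬loop with partner D (bottomLo i) Fin.≟ bottomHi i
  ... | yes loop = ⊥-elim (¬loop loop)
  ... | no _     = refl

  -- TLₙ(2) acts on linear combinations of matchings by stacking diagrams
  -- below them.  This is the transposed action on functions of matchings.
  act : TL → (Matching → |K|) → (Matching → |K|)
  act (ι a)   g D = a * g D
  act (t i)   g D = loopFactor D i * g (stack D i)
  act (x ⊕ y) g D = act x g D +ᴷ act y g D
  act (x ⊗ y) g D = act x (act y g) D

  -- Functions are compared on perfect matchings only: the stacking rules behind the relations, such
  -- as `stack-idempotent`, are proved for involutions without fixed points, and stacking preserves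
  -- these.
  act-cong : ∀ x {g g′} → (∀ {D} → Paired D → g D ≈ g′ D) → ∀ {D} → Paired D → act x g D ≈ act x g′ D
  act-cong (ι a)   g≈g′ P = *-congˡ (g≈g′ P)
  act-cong (t i)   g≈g′ P = *-congˡ (g≈g′ (stack-paired P i))
  act-cong (x ⊕ y) g≈g′ P = +-cong (act-cong x g≈g′ P) (act-cong y g≈g′ P)
  act-cong (x ⊗ y) g≈g′ P = act-cong x (act-cong y g≈g′) P

  -- Linearity in the function of matchings is what the relation `⊗-distribˡ` amounts to under
  -- `act`. In the same way `act-*` is what `ι-central` amounts to.
  act-+ : ∀ x {g h D} → Paired D → act x (λ E → g E +ᴷ h E) D ≈ act x g D +ᴷ act x h D
  act-+ (ι a)   P = distribˡ _ _ _
  act-+ (t i)   P = distribˡ _ _ _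
  act-+ (x ⊕ y) P = ≈-trans (+-cong (act-+ x P) (act-+ y P)) (interchange _ _ _ _)
  act-+ (x ⊗ y) P = ≈-trans (act-cong x (act-+ y) P) (act-+ x P)

  act-* : ∀ x {g D} a → Paired D → act x (λ E → a * g E) D ≈ a * act x g D
  act-* (ι b)   a P = x∙yz≈y∙xz _ _ _
  act-* (t i)   a P = x∙yz≈y∙xz _ _ _
  act-* (x ⊕ y) a P = ≈-trans (+-cong (act-* x a P) (act-* y a P)) (≈-sym (distribˡ _ _ _))
  act-* (x ⊗ y) a P = ≈-trans (act-cong x (act-* y a) P) (act-* x a P)

  private
    1*1*x : ∀ {a b c x} → b ≡ 1# → c ≡ 1# → a * (b * (c * x)) ≈ a * x
    1*1*x refl refl = *-congˡ (≈-trans (*-identityˡ _) (*-identityˡ _))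

  loopFactor-commute : ∀ {D} → Paired D → ∀ i j → 2 ≤ ℕ.∣ toℕ i - toℕ j ∣ →
                       loopFactor D i * loopFactor (stack D i) j ≈ loopFactor D j * loopFactor (stack D j) i
  loopFactor-commute {D} P i j 2≤ = go
    (partner D (bottomLo i) Fin.≟ bottomHi i) (partner D (bottomLo j) Fin.≟ bottomHi j)
    (partner (stack D i) (bottomLo j) Fin.≟ bottomHi j) (partner (stack D j) (bottomLo i) Fin.≟ bottomHi i)
    where
    2≤′ : 2 ≤ ℕ.∣ toℕ j - toℕ i ∣
    2≤′ = subst (2 ≤_) (ℕ.∣-∣-comm (toℕ i) (toℕ j)) 2≤
    go : Dec (Closes i D) → Dec (Closes j D) → Dec (Closes j (stack D i)) → Dec (Closes i (stack D j)) →
         loopFactor D i * loopFactor (stack D i) j ≈ loopFactor D j * loopFactor (stack D j) i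
    go (yes ci) (yes cj) _ _
      rewrite loopFactor-loop {D} ci | loopFactor-loop {D} cj
            | loopFactor-loop (stack-keepsLoop P i j 2≤ ci) | loopFactor-loop (stack-keepsLoop P j i 2≤′ cj) = ≈-refl
    go (yes ci) (no ¬cj) _ _
      rewrite loopFactor-loop {D} ci | loopFactor-noLoop {D} ¬cj
            | loopFactor-loop (stack-keepsLoop P i j 2≤ ci)
            | loopFactor-noLoop (¬cj ∘ stack-keepsLoop⁻¹ P i j 2≤ ci) = *-comm _ _
    go (no ¬ci) (yes cj) _ _
      rewrite loopFactor-noLoop {D} ¬ci | loopFactor-loop {D} cj
            | loopFactor-loop (stack-keepsLoop P j i 2≤′ cj)
            | loopFactor-noLoop (¬ci ∘ stack-keepsLoop⁻¹ P j i 2≤′ cj) = *-comm _ _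
    go (no ¬ci) (no ¬cj) (yes cj) _
      rewrite loopFactor-noLoop {D} ¬ci | loopFactor-noLoop {D} ¬cj
            | loopFactor-loop cj | loopFactor-loop (stack-exchangesLoop P i j 2≤ ¬cj cj) = ≈-refl
    go (no ¬ci) (no ¬cj) (no ¬cj′) (yes ci) = ⊥-elim (¬cj′ (stack-exchangesLoop P j i 2≤′ ¬ci ci))
    go (no ¬ci) (no ¬cj) (no ¬cj′) (no ¬ci′)
      rewrite loopFactor-noLoop {D} ¬ci | loopFactor-noLoop {D} ¬cj
            | loopFactor-noLoop ¬cj′ | loopFactor-noLoop ¬ci′ = ≈-refl

  act-sound : ∀ {x y} → x ≋ y → ∀ g {D} → Paired D → act x g D ≈ act y g D
  act-sound ≋-refl          g P = ≈-refl
  act-sound (≋-sym e)       g P = ≈-sym (act-sound e g P)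
  act-sound (≋-trans e e′)  g P = ≈-trans (act-sound e g P) (act-sound e′ g P)
  act-sound (⊕-cong e e′)   g P = +-cong (act-sound e g P) (act-sound e′ g P)
  act-sound (⊗-cong {x} {y = y} {y′} e e′) g P =
    ≈-trans (act-cong x {act y g} (act-sound e′ g) P) (act-sound e (act y′ g) P)
  act-sound (⊕-assoc x y z) g P = +-assoc _ _ _
  act-sound (⊕-comm x y)    g P = +-comm _ _
  act-sound (⊕-identity x)  g P = ≈-trans (+-congʳ (zeroˡ _)) (+-identityˡ _)
  act-sound (⊗-assoc x y z) g P = ≈-refl
  act-sound (⊗-identity x)  g P = *-identityˡ _
  act-sound (⊗-zero x)      g P = ≈-trans (zeroˡ _) (≈-sym (zeroˡ _))
  act-sound (⊗-distribˡ x y z) g P = act-+ x P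
  act-sound (⊗-distribʳ x y z) g P = ≈-refl
  act-sound (ι-cong e)      g P = *-congʳ e
  act-sound (ι-+ a b)       g P = distribʳ _ _ _
  act-sound (ι-* a b)       g P = *-assoc _ _ _
  act-sound (ι-central a x) g P = ≈-sym (act-* x a P)
  act-sound (t-square i)    g {D} P
    rewrite stack-idempotent P i | loopFactor-loop (stack-closes D i) = x∙yz≈y∙xz _ _ _
  act-sound (t-braid i j adjacent) g {D} P rewrite Braids.restores (stack-braid P i j adjacent) =
    1*1*x (loopFactor-noLoop (Braids.noLoop₁ braids)) (loopFactor-noLoop (Braids.noLoop₂ braids))
    where braids = stack-braid P i j adjacent
  act-sound (t-commute i j 2≤) g P rewrite stack-commute P i j 2≤ =
    ≈-trans (≈-sym (*-assoc _ _ _)) (≈-trans (*-congʳ (loopFactor-commute P i j 2≤)) (*-assoc _ _ _))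

  δ : Matching → Matching → |K|
  δ T D = if does (Vec.≡-dec Fin._≟_ D T) then 1# else 0#

  δ-same : ∀ T → δ T T ≡ 1#
  δ-same T with Vec.≡-dec Fin._≟_ T T
  ... | yes _   = refl
  ... | no T≢T = ⊥-elim (T≢T refl)

  δ-different : ∀ {D T} → D ≢ T → δ T D ≡ 0#
  δ-different {D} {T} D≢T with Vec.≡-dec Fin._≟_ D T
  ... | yes D≡T = ⊥-elim (D≢T D≡T)
  ... | no _    = refl

  act-word : ∀ g {D v} → NoLoopBelow D v → act ⟦ v ⟧ g D ≈ g (foldl stack D v)
  act-word g [] = *-identityˡ _
  act-word g {D} (_∷_ {i} noLoop rest) = ≈-trans
    (*-congʳ (reflexive (loopFactor-noLoop (subst ¬_ (sym (closes≡closesLoop i D)) noLoop))))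
    (≈-trans (*-identityˡ _) (act-word g rest))

  act-value : ∀ T E → act (value E) (δ T) identity ≈ coefficientIn T E
  act-value T [] = zeroˡ _
  act-value T ((a , v) ∷ E) with ih ← act-value T E | act-word (δ T) (loopFree v)
  ... | onWord with Vec.≡-dec Fin._≟_ (diagram (word v)) T
  ... | yes _ = +-cong (≈-trans (*-congˡ onWord) (*-identityʳ a)) ih
  ... | no  _ = ≈-trans (+-cong (≈-trans (*-congˡ onWord) (zeroʳ a)) ih) (+-identityˡ _)

  -- Loop-free words act with factor 1, so evaluating an expansion at `δ T` collects exactly its
  -- terms with diagram T. The right side does not mention the expansion, which gives uniqueness of
  -- the coefficient and its invariance under `_≋_`.
  coefficient-unique : ∀ {T x y a} → x ≋ y → IsCoefficient T x a → a ≈ act y (δ T) identity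
  coefficient-unique {T} {x} {y} {a} x≋y (E , x≋E , a≈) = begin
    a                              ≈⟨ a≈ ⟩
    coefficientIn T E              ≈⟨ act-value T E ⟨
    act (value E) (δ T) identity   ≈⟨ act-sound x≋E (δ T) identityPaired ⟨
    act x (δ T) identity           ≈⟨ act-sound x≋y (δ T) identityPaired ⟩
    act y (δ T) identity           ∎
    where identityPaired = Below.paired below-identity

  -- Coefficients of the increasing products of tᵢ - 1

  product-θs : ∀ {r} → Subset r → (Fin r → Fin (n ∸ 1)) → TL
  product-θs []            ε = ι 1#
  product-θs (inside  ∷ S) ε = (t (ε zero) ⊕ ι (- 1#)) ⊗ product-θs S (ε ∘ suc)
  product-θs (outside ∷ S) ε = product-θs S (ε ∘ suc)

  act-factor : ∀ {D} i y g → Below (toℕ i) D →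
               act ((t i ⊕ ι (- 1#)) ⊗ y) g D ≈ act y g (stack D i) +ᴷ - 1# * act y g D
  act-factor i y g B = +-congʳ (≈-trans (*-congʳ (reflexive (loopFactor-noLoop (below-noLoop i B)))) (*-identityˡ _))

  -- The diagrams D and T already differ in the information about an index `j` below `o`. The
  -- remaining factors have indices at least `o` and cannot repair this, so no term of the product
  -- reaches T.
  act-disagree : ∀ {r o D T} (S : Subset r) {ε} → ε ≡ o +offset → Below o D →
                 ∀ j → toℕ j < o → ¬ Agree j D T → act (product-θs S ε) (δ T) D ≈ 0#
  act-disagree {D = D} {T} [] off B j j<o ¬agree =
    ≈-trans (*-congˡ (reflexive (δ-different {D} {T} λ { refl → ¬agree (id , id) }))) (zeroʳ _)
  act-disagree (outside ∷ S) off B j j<o ¬agree =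
    act-disagree S (offset-suc off) (below-skip B) j (ℕ.<-trans j<o (ℕ.n<1+n _)) ¬agree
  act-disagree {o = o} {D} {T} (inside ∷ S) {ε} off B j j<o ¬agree with offset-zero off
  ... | refl = begin
    act (product-θs (inside ∷ S) ε) (δ T) D                ≈⟨ act-factor (ε zero) rest (δ T) B ⟩
    act rest (δ T) (stack D (ε zero)) +ᴷ - 1# * act rest (δ T) D
      ≈⟨ +-cong (act-disagree S (offset-suc off) (below-stack (ε zero) B) j j<1+o
                  λ (f , g) → ¬agree (f ∘ proj₂ persists , proj₁ persists ∘ g))
                (*-congˡ (act-disagree S (offset-suc off) (below-skip B) j j<1+o ¬agree)) ⟩
    0# +ᴷ - 1# * 0#                                         ≈⟨ +-identityˡ _ ⟩
    - 1# * 0#                                               ≈⟨ zeroʳ _ ⟩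
    0#                                                      ∎
    where
    rest = product-θs S (ε ∘ suc)
    j<1+o = ℕ.<-trans j<o (ℕ.n<1+n _)
    persists = leftward-persists (ε zero) B j j<o

  -- Each factor tᵢ - 1 offers the choice between drawing tᵢ and omitting it with a sign. Only the
  -- choice prescribed by I survives, the other being killed by `act-disagree`. If i ∈ I but i ∉ S,
  -- there is no factor that could draw tᵢ, and the result is 0.
  act-run : ∀ {r o D} (I S : Subset r) {ε} → ε ≡ o +offset → Below o D →
            act (product-θs S ε) (δ (run D I ε)) D ≈ weight I S
  act-run {D = D} [] [] off B = ≈-trans (*-identityˡ _) (reflexive (δ-same D))
  act-run (outside ∷ I) (outside ∷ S) {ε} off B = act-run I S {ε ∘ suc} (offset-suc off) (below-skip B)
  act-run {o = o} {D} (inside ∷ I) (outside ∷ S) {ε} off B with offset-zero off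
  ... | refl = act-disagree S (offset-suc off) (below-skip B) (ε zero) (ℕ.n<1+n _)
    λ (f , g) → leftward-stack (ε zero) B (proj₁ agree (f (leftward-skip (ε zero) B)))
    where agree = run-agree I (offset-suc off) (below-stack (ε zero) B) (ε zero) (ℕ.n<1+n _)
  act-run {o = o} {D} (inside ∷ I) (inside ∷ S) {ε} off B with offset-zero off
  ... | refl = begin
    act (product-θs (inside ∷ S) ε) (δ T) D                ≈⟨ act-factor (ε zero) rest (δ T) B ⟩
    act rest (δ T) (stack D (ε zero)) +ᴷ - 1# * act rest (δ T) D
      ≈⟨ +-cong (act-run I S (offset-suc off) (below-stack (ε zero) B))
                (*-congˡ (act-disagree S (offset-suc off) (below-skip B) (ε zero) (ℕ.n<1+n _)
                  λ (f , g) → leftward-stack (ε zero) B (proj₁ agree (f (leftward-skip (ε zero) B))))) ⟩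
    weight I S +ᴷ - 1# * 0#                                 ≈⟨ +-congˡ (zeroʳ _) ⟩
    weight I S +ᴷ 0#                                        ≈⟨ +-identityʳ _ ⟩
    weight I S                                              ∎
    where
    rest = product-θs S (ε ∘ suc)
    T = run (stack D (ε zero)) I (ε ∘ suc)
    agree = run-agree I (offset-suc off) (below-stack (ε zero) B) (ε zero) (ℕ.n<1+n _)
  act-run {o = o} {D} (outside ∷ I) (inside ∷ S) {ε} off B with offset-zero off
  ... | refl = begin
    act (product-θs (inside ∷ S) ε) (δ T) D                ≈⟨ act-factor (ε zero) rest (δ T) B ⟩
    act rest (δ T) (stack D (ε zero)) +ᴷ - 1# * act rest (δ T) D
      ≈⟨ +-cong (act-disagree S (offset-suc off) (below-stack (ε zero) B) (ε zero) (ℕ.n<1+n _)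
                  λ (f , g) → leftward-stack (ε zero) B (g (proj₂ agree (leftward-skip (ε zero) B))))
                (*-congˡ (act-run I S (offset-suc off) (below-skip B))) ⟩
    0# +ᴷ - 1# * weight I S                                 ≈⟨ +-identityˡ _ ⟩
    - 1# * weight I S                                       ∎
    where
    rest = product-θs S (ε ∘ suc)
    T = run D I (ε ∘ suc)
    agree = run-agree I (offset-suc off) (below-skip B) (ε zero) (ℕ.n<1+n _)

  module _ {T : Matching} {f : Permutation′ n → |K|} (isTLFunction : IsTLFunction T f) where
    open IsTLFunction isTLFunction
    open IsTheta isTheta

    -- A permutation has many representatives. The expansions below replace those listed in
    -- `permutations` by ones built with `lift₀` and `glue`, so `f` must not distinguish them.
    TLFunction-cong : ∀ {v w} → v Perm.≈ w → f v ≈ f w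
    TLFunction-cong {v} {w} v≈w = ≈-trans (coefficient-unique (θ-cong v≈w) (coefficient v))
                                         (≈-sym (coefficient-unique ≋-refl (coefficient w)))

    θ-product-s : ∀ {r} (S : Subset r) ε → θ (product-s n S ε) ≋ product-θs S ε
    θ-product-s []            ε = θ-id
    θ-product-s (inside  ∷ S) ε = ≋-trans (θ-∘ _ _) (⊗-cong (θ-s (ε zero)) (θ-product-s S (ε ∘ suc)))
    θ-product-s (outside ∷ S) ε = θ-product-s S (ε ∘ suc)

  TLFunction-product-s : ∀ I {f} → IsTLFunction (τ I) f → ∀ S → f (product-s n S id) ≈ weight I S
  TLFunction-product-s I {f} isTLFunction S = begin
    f (product-s n S id)
      ≈⟨ coefficient-unique (θ-product-s isTLFunction S id) (IsTLFunction.coefficient isTLFunction _) ⟩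
    act (product-θs S id) (δ (τ I)) identity
      ≡⟨ cong (λ T → act (product-θs S id) (δ T) identity) (τ≡run I) ⟩
    act (product-θs S id) (δ (run identity I id)) identity
      ≈⟨ act-run I S (λ _ → refl) below-identity ⟩
    weight I S ∎

-- Immanants of Hessenberg matrices

glue : ∀ {n} → Permutation′ (suc n) → Permutation′ (suc (suc n))
glue w = s zero ∘ₚ lift₀ w

module _ where
  open MonoidSum ℕ.+-0-monoid using (sum; sum-cong-≗; sum-replicate-zero)

  inversions-cong : ∀ {n} (v w : Permutation′ n) → v Perm.≈ w → inversions v ≡ inversions w
  inversions-cong {n} v w v≈w = sum-cong-≗ λ i → sum-cong-≗ λ j → indicator i j (v≈w i) (v≈w j)
    where
    indicator : ∀ (i j : Fin n) {vi wi vj wj : Fin n} → vi ≡ wi → vj ≡ wj →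
                (if does (i Fin.<? j) ∧ does (vj Fin.<? vi) then 1 else 0) ≡
                (if does (i Fin.<? j) ∧ does (wj Fin.<? wi) then 1 else 0)
    indicator i j refl refl = refl

  inversions-lift₀ : ∀ {n} (w : Permutation′ n) → inversions (lift₀ w) ≡ inversions w
  inversions-lift₀ {n} w = cong (_+ inversions w) (sum-replicate-zero n)

  -- The pair of positions 0 and 1 is the one new inversion. Position 1 has the smallest value and
  -- starts none, which is the vanishing sum `z`; position 0 inherits the inversions of position 0
  -- of `w`.
  inversions-glue : ∀ {n} (w : Permutation′ (suc n)) → inversions (glue w) ≡ suc (inversions w)
  inversions-glue {n} w = cong (λ z → suc (firstRow + (z + laterRows))) (sum-replicate-zero n)
    where
    firstRow  = sum λ j → if does ((w ⟨$⟩ʳ suc j) Fin.<? (w ⟨$⟩ʳ zero)) then 1 else 0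
    laterRows = sum λ i → sum λ j →
      if does (suc i Fin.<? j) ∧ does ((w ⟨$⟩ʳ j) Fin.<? (w ⟨$⟩ʳ suc i)) then 1 else 0

  inversions-id : ∀ n → inversions (Perm.id {n}) ≡ 0
  inversions-id zero    = refl
  inversions-id (suc n) =
    trans (inversions-cong Perm.id (lift₀ (Perm.id {n})) (sym ∘ Perm.lift₀-id))
          (trans (inversions-lift₀ (Perm.id {n})) (inversions-id n))

kept : ∀ {k} → Subset k → (ℕ → ℕ) → List ℕ
kept []            Q = []
kept (inside  ∷ I) Q = kept I (Q ∘ suc)
kept (outside ∷ I) Q = Q 0 ∷ kept I (Q ∘ suc)

module Expansions {a ℓa} (A : CommutativeRing a ℓa) where

  open CommutativeRing A hiding (zero) renaming (_+_ to _+ᴬ_; refl to ≈-refl; sym to ≈-sym; trans to ≈-trans)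
  open import Algebra.Definitions.RawSemiring (Semiring.rawSemiring (CommutativeRing.semiring A)) using (product; _^_)
  open Immanants A
  open SubsetWeights A
  open SetoidReasoning setoid
  open MonoidSum *-monoid using () renaming (sum-cong-≋ to product-cong)
  open CommutativeSemigroupProperties *-commutativeSemigroup using (x∙yz≈y∙xz)

  Respects≈ : ∀ {n} → (Permutation′ n → Carrier) → Set ℓa
  Respects≈ f = ∀ v w → v Perm.≈ w → f v ≈ f w

  ∑-cong : ∀ {b} {X : Set b} {g h : X → Carrier} → (∀ x → g x ≈ h x) → ∀ xs → ∑ (map g xs) ≈ ∑ (map h xs)
  ∑-cong g≈h []       = ≈-refl
  ∑-cong g≈h (x ∷ xs) = +-cong (g≈h x) (∑-cong g≈h xs)

  ∑-zero : ∀ {b} {X : Set b} {g : X → Carrier} → (∀ x → g x ≈ 0#) → ∀ xs → ∑ (map g xs) ≈ 0#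
  ∑-zero g≈0 []       = ≈-refl
  ∑-zero g≈0 (x ∷ xs) = ≈-trans (+-cong (g≈0 x) (∑-zero g≈0 xs)) (+-identityˡ 0#)

  ∑-* : ∀ {b} {X : Set b} c (g : X → Carrier) xs → ∑ (map (λ x → c * g x) xs) ≈ c * ∑ (map g xs)
  ∑-* c g []       = ≈-sym (zeroʳ c)
  ∑-* c g (x ∷ xs) = ≈-trans (+-congˡ (∑-* c g xs)) (≈-sym (distribˡ c _ _))

  ∑-++ : ∀ xs ys → ∑ (xs ++ ys) ≈ ∑ xs +ᴬ ∑ ys
  ∑-++ []       ys = ≈-sym (+-identityˡ _)
  ∑-++ (x ∷ xs) ys = ≈-trans (+-congˡ (∑-++ xs ys)) (≈-sym (+-assoc _ _ _))

  ∑-cartesian : ∀ {b} {X Y Z : Set b} (F : X → Y → Z) (g : Z → Carrier) xs ys →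
                ∑ (map g (cartesianProductWith F xs ys)) ≈ ∑ (map (λ x → ∑ (map (g ∘ F x) ys)) xs)
  ∑-cartesian F g []       ys = ≈-refl
  ∑-cartesian F g (x ∷ xs) ys = begin
    ∑ (map g (map (F x) ys ++ cartesianProductWith F xs ys))
      ≡⟨ cong ∑ (List.map-++ g (map (F x) ys) _) ⟩
    ∑ (map g (map (F x) ys) ++ map g (cartesianProductWith F xs ys))
      ≈⟨ ∑-++ (map g (map (F x) ys)) _ ⟩
    ∑ (map g (map (F x) ys)) +ᴬ ∑ (map g (cartesianProductWith F xs ys))
      ≈⟨ +-cong (reflexive (cong ∑ (sym (List.map-∘ ys)))) (∑-cartesian F g xs ys) ⟩
    ∑ (map (g ∘ F x) ys) +ᴬ ∑ (map (λ x → ∑ (map (g ∘ F x) ys)) xs) ∎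

  ∑-allFin-suc : ∀ {n} (g : Fin (suc n) → Carrier) →
                 ∑ (map g (allFin (suc n))) ≡ g zero +ᴬ ∑ (map (g ∘ suc) (allFin n))
  ∑-allFin-suc g = cong (λ l → g zero +ᴬ ∑ l)
    (trans (List.map-tabulate suc g) (sym (List.map-tabulate id (g ∘ suc))))

  ∑-permutations : ∀ {n} (g : Permutation′ (suc n) → Carrier) →
                   ∑ (map g (permutations (suc n))) ≈
                   ∑ (map (g ∘ insert zero zero) (permutations n)) +ᴬ
                   ∑ (map (λ j → ∑ (map (g ∘ insert zero (suc j)) (permutations n))) (allFin n))
  ∑-permutations {n} g = ≈-trans (∑-cartesian (insert zero) g (allFin (suc n)) (permutations n))
    (reflexive (∑-allFin-suc λ j → ∑ (map (g ∘ insert zero j) (permutations n))))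

  product-zero : ∀ {n} {g : Fin n → Carrier} i → g i ≈ 0# → product g ≈ 0#
  product-zero zero    g≈0 = ≈-trans (*-congʳ g≈0) (zeroˡ _)
  product-zero (suc i) g≈0 = ≈-trans (*-congˡ (product-zero i g≈0)) (zeroʳ _)

  product-one : ∀ {n} {g : Fin n → Carrier} → (∀ i → g i ≈ 1#) → product g ≈ 1#
  product-one {zero}  g≈1 = ≈-refl
  product-one {suc n} g≈1 = ≈-trans (*-cong (g≈1 zero) (product-one (g≈1 ∘ suc))) (*-identityˡ 1#)

  -- What is left of a product over w after removing its entry from column 0: `minor` if w(0) = 0,
  -- `contract` if w(1) = 0. The remaining permutation enters `f` through `lift₀` and `glue`
  -- respectively.
  minor contract : ∀ {n} → Matrix (suc n) → Matrix n
  minor M i j = M (suc i) (suc j)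
  contract M zero    j = M zero (suc j)
  contract M (suc i) j = M (suc (suc i)) (suc j)

  term : ∀ {n} → (Permutation′ n → Carrier) → Matrix n → Permutation′ n → Carrier
  term f M w = f w * product λ i → M i (w ⟨$⟩ʳ i)

  glue-cong : ∀ {n} (v w : Permutation′ (suc n)) → v Perm.≈ w → glue v Perm.≈ glue w
  glue-cong v w v≈w i = Perm.lift₀-cong v w v≈w (s zero ⟨$⟩ʳ i)

  module _ {n} {f : Permutation′ (suc n) → Carrier} (f-resp : Respects≈ f) (M : Matrix (suc n)) where

    term-cong : ∀ v w → v Perm.≈ w → term f M v ≈ term f M w
    term-cong v w v≈w = *-cong (f-resp v w v≈w) (product-cong λ i → reflexive (cong (M i) (v≈w i)))

    term-zero : ∀ w {i} → w ⟨$⟩ˡ zero ≡ i → M i zero ≈ 0# → term f M w ≈ 0#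
    term-zero w refl M≈0 = ≈-trans (*-congˡ (product-zero {g = λ i → M i (w ⟨$⟩ʳ i)} (w ⟨$⟩ˡ zero)
      (≈-trans (reflexive (cong (M _) (Perm.inverseʳ w {zero}))) M≈0))) (zeroʳ _)

    term-insert : ∀ w → term f M (insert zero zero w) ≈ M zero zero * term (f ∘ lift₀) (minor M) w
    term-insert w = ≈-trans (term-cong (insert zero zero w) (lift₀ w) insert≈lift₀) (x∙yz≈y∙xz _ _ _)
      where
      insert≈lift₀ : insert zero zero w Perm.≈ lift₀ w
      insert≈lift₀ zero    = refl
      insert≈lift₀ (suc i) = refl

    term-insert-zero : (∀ i → M (suc i) zero ≈ 0#) → ∀ j w → term f M (insert zero (suc j) w) ≈ 0#
    term-insert-zero M≈0 j w = go _ refl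
      where
      v = insert zero (suc j) w
      go : ∀ i → v ⟨$⟩ˡ zero ≡ i → term f M v ≈ 0#
      go (suc i) eq = term-zero v eq (M≈0 i)
      go zero    eq with trans (sym (cong (v ⟨$⟩ʳ_) eq)) (Perm.inverseʳ v {zero})
      ... | ()

    ∑-insert : ∑ (map (term f M ∘ insert zero zero) (permutations n)) ≈
               M zero zero * Imm (f ∘ lift₀) (minor M)
    ∑-insert = ≈-trans (∑-cong term-insert (permutations n)) (∑-* _ (term (f ∘ lift₀) (minor M)) (permutations n))

    Imm-expand₁ : (∀ i → M (suc i) zero ≈ 0#) → Imm f M ≈ M zero zero * Imm (f ∘ lift₀) (minor M)
    Imm-expand₁ M≈0 = begin
      Imm f M ≈⟨ ∑-permutations (term f M) ⟩
      ∑ (map (term f M ∘ insert zero zero) (permutations n)) +ᴬ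
      ∑ (map (λ j → ∑ (map (term f M ∘ insert zero (suc j)) (permutations n))) (allFin n))
        ≈⟨ +-cong ∑-insert (∑-zero (λ j → ∑-zero (term-insert-zero M≈0 j) (permutations n)) (allFin n)) ⟩
      M zero zero * Imm (f ∘ lift₀) (minor M) +ᴬ 0# ≈⟨ +-identityʳ _ ⟩
      M zero zero * Imm (f ∘ lift₀) (minor M) ∎

  module _ {n} {f : Permutation′ (suc (suc n)) → Carrier} (f-resp : Respects≈ f) (M : Matrix (suc (suc n)))
           (M≈0 : ∀ i → M (suc (suc i)) zero ≈ 0#) where

    private
      insert-insert≈glue : ∀ j (w : Permutation′ n) → insert zero (suc j) (insert zero zero w) Perm.≈ glue (insert zero j w)
      insert-insert≈glue j w zero          = refl
      insert-insert≈glue j w (suc zero)    = refl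
      insert-insert≈glue j w (suc (suc i)) = refl

      term-glue : ∀ w → term f M (glue w) ≈ M (suc zero) zero * term (f ∘ glue) (contract M) w
      term-glue w = ≈-trans (*-congˡ (x∙yz≈y∙xz _ _ _)) (x∙yz≈y∙xz _ _ _)

      term-insert-insert-zero : ∀ j k w → term f M (insert zero (suc j) (insert zero (suc k) w)) ≈ 0#
      term-insert-insert-zero j k w = go _ refl
        where
        v = insert zero (suc j) (insert zero (suc k) w)
        image : ∀ {i} → v ⟨$⟩ˡ zero ≡ i → v ⟨$⟩ʳ i ≡ zero
        image eq = trans (sym (cong (v ⟨$⟩ʳ_) eq)) (Perm.inverseʳ v {zero})
        go : ∀ i → v ⟨$⟩ˡ zero ≡ i → term f M v ≈ 0#
        go zero          eq with image eq
        ... | ()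
        go (suc zero)    eq with image eq
        ... | ()
        go (suc (suc i)) eq = term-zero f-resp M v eq (M≈0 i)

      column : ∀ j → ∑ (map (term f M ∘ insert zero (suc j)) (permutations (suc n))) ≈
                     ∑ (map (term f M ∘ glue ∘ insert zero j) (permutations n))
      column j = begin
        ∑ (map (term f M ∘ insert zero (suc j)) (permutations (suc n)))
          ≈⟨ ∑-permutations (term f M ∘ insert zero (suc j)) ⟩
        ∑ (map (term f M ∘ insert zero (suc j) ∘ insert zero zero) (permutations n)) +ᴬ
        ∑ (map (λ k → ∑ (map (term f M ∘ insert zero (suc j) ∘ insert zero (suc k)) (permutations n))) (allFin n))
          ≈⟨ +-cong (∑-cong (λ w → term-cong f-resp M _ (glue (insert zero j w)) (insert-insert≈glue j w)) (permutations n))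
                    (∑-zero (λ k → ∑-zero (term-insert-insert-zero j k) (permutations n)) (allFin n)) ⟩
        ∑ (map (term f M ∘ glue ∘ insert zero j) (permutations n)) +ᴬ 0#
          ≈⟨ +-identityʳ _ ⟩
        ∑ (map (term f M ∘ glue ∘ insert zero j) (permutations n)) ∎

    -- `permutations` branches on the image of 0, but the zeros of M are in column 0, so the
    -- preimage of 0 matters. For w(0) ≠ 0 a second branching on w(1) isolates w(1) = 0; otherwise
    -- the preimage is at least 2 and the term vanishes. The surviving terms are regrouped as a sum
    -- over all `glue w`.
    Imm-expand₂ : Imm f M ≈ M zero zero * Imm (f ∘ lift₀) (minor M) +ᴬ
                            M (suc zero) zero * Imm (f ∘ glue) (contract M)
    Imm-expand₂ = begin
      Imm f M ≈⟨ ∑-permutations (term f M) ⟩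
      ∑ (map (term f M ∘ insert zero zero) (permutations (suc n))) +ᴬ
      ∑ (map (λ j → ∑ (map (term f M ∘ insert zero (suc j)) (permutations (suc n)))) (allFin (suc n)))
        ≈⟨ +-cong (∑-insert f-resp M) (∑-cong column (allFin (suc n))) ⟩
      M zero zero * Imm (f ∘ lift₀) (minor M) +ᴬ
      ∑ (map (λ j → ∑ (map (term f M ∘ glue ∘ insert zero j) (permutations n))) (allFin (suc n)))
        ≈⟨ +-congˡ (∑-cartesian (insert zero) (term f M ∘ glue) (allFin (suc n)) (permutations n)) ⟨
      M zero zero * Imm (f ∘ lift₀) (minor M) +ᴬ ∑ (map (term f M ∘ glue) (permutations (suc n)))
        ≈⟨ +-congˡ (≈-trans (∑-cong term-glue (permutations (suc n)))
                             (∑-* _ (term (f ∘ glue) (contract M)) (permutations (suc n)))) ⟩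
      M zero zero * Imm (f ∘ lift₀) (minor M) +ᴬ M (suc zero) zero * Imm (f ∘ glue) (contract M) ∎

  lift₀-resp : ∀ {n} {f : Permutation′ (suc n) → Carrier} → Respects≈ f → Respects≈ (f ∘ lift₀)
  lift₀-resp f-resp v w v≈w = f-resp (lift₀ v) (lift₀ w) (Perm.lift₀-cong v w v≈w)

  glue-resp : ∀ {n} {f : Permutation′ (suc (suc n)) → Carrier} → Respects≈ f → Respects≈ (f ∘ glue)
  glue-resp f-resp v w v≈w = f-resp (glue v) (glue w) (glue-cong v w v≈w)

  Imm-unitriangular : ∀ {n} {f : Permutation′ n → Carrier} → Respects≈ f → (M : Matrix n) →
                      (∀ i j → toℕ j < toℕ i → M i j ≈ 0#) → (∀ i → M i i ≈ 1#) → Imm f M ≈ f Perm.id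
  Imm-unitriangular {zero}      f-resp M lower diagonal = ≈-trans (+-identityʳ _) (*-identityʳ _)
  Imm-unitriangular {suc n} {f} f-resp M lower diagonal = begin
    Imm f M                                 ≈⟨ Imm-expand₁ f-resp M (λ i → lower (suc i) zero (s≤s z≤n)) ⟩
    M zero zero * Imm (f ∘ lift₀) (minor M) ≈⟨ *-cong (diagonal zero) (Imm-unitriangular (lift₀-resp {f = f} f-resp) (minor M)
                                                (λ i j j<i → lower (suc i) (suc j) (s≤s j<i)) (diagonal ∘ suc)) ⟩
    1# * f (lift₀ Perm.id)                  ≈⟨ *-identityˡ _ ⟩
    f (lift₀ Perm.id)                       ≈⟨ f-resp (lift₀ Perm.id) Perm.id Perm.lift₀-id ⟩
    f Perm.id                               ∎

  -- The end point of each row is the start of the next. The start `a` of the first row is a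
  -- separate parameter, since `minor` moves it to `Q 0` while `contract` keeps it.
  rowStart : ℕ → (ℕ → ℕ) → ℕ → ℕ
  rowStart a Q zero    = a
  rowStart a Q (suc i) = Q i

  -- In the application h q p is the product of the e_{q-p}(x⁽ʳ⁾).
  module Chains (h : ℕ → ℕ → Carrier) (h-diagonal : ∀ p → h p p ≈ 1#) (h-zero : ∀ {q p} → q < p → h q p ≈ 0#) where

    -- Sum over the sets C = {c₁ < … < cᵣ} of elements of ps of
    -- (-1)^(length ps - r) h(c₁,a) h(c₂,c₁) ⋯ h(m,cᵣ).
    chainSum : ℕ → List ℕ → ℕ → Carrier
    chainSum a []       m = h m a
    chainSum a (p ∷ ps) m = h p a * chainSum p ps m +ᴬ - 1# * chainSum a ps m

    -- Rows 0, ..., k carry the ribbon. The rows after them form a unitriangular tail, which occurs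
    -- when a Jacobi-Trudi matrix is larger than the number of rows of the shape. `Q k` is the end
    -- of the last ribbon row and starts none of them, hence the bound `j < k` in `increasing`.
    record IsChainMatrix {n} (M : Matrix (suc n)) (k a : ℕ) (Q : ℕ → ℕ) : Set (ℓa) where
      field
        entry        : ∀ i j → toℕ i ≤ k → toℕ j ≤ k → M i j ≈ h (Q (toℕ j)) (rowStart a Q (toℕ i))
        increasing   : ∀ {i j} → i < j → j < k → Q i < Q j
        tailBelow    : ∀ i j → k < toℕ i → toℕ j < toℕ i → M i j ≈ 0#
        tailDiagonal : ∀ i → k < toℕ i → M i i ≈ 1#

    module _ {n k a Q} {M : Matrix (suc (suc n))} (chain : IsChainMatrix M (suc k) a Q) where
      open IsChainMatrix chain

      minor-chain : IsChainMatrix (minor M) k (Q 0) (Q ∘ suc)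
      minor-chain = record
        { entry        = λ { zero    j i≤k j≤k → entry (suc zero) (suc j) (s≤s z≤n) (s≤s j≤k)
                           ; (suc i) j i≤k j≤k → entry (suc (suc i)) (suc j) (s≤s i≤k) (s≤s j≤k) }
        ; increasing   = λ i<j j<k → increasing (s≤s i<j) (s≤s j<k)
        ; tailBelow    = λ i j k<i j<i → tailBelow (suc i) (suc j) (s≤s k<i) (s≤s j<i)
        ; tailDiagonal = λ i k<i → tailDiagonal (suc i) (s≤s k<i)
        }

      contract-chain : IsChainMatrix (contract M) k a (Q ∘ suc)
      contract-chain = record
        { entry        = λ { zero    j i≤k j≤k → entry zero (suc j) z≤n (s≤s j≤k)
                           ; (suc i) j i≤k j≤k → entry (suc (suc i)) (suc j) (s≤s i≤k) (s≤s j≤k) }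
        ; increasing   = λ i<j j<k → increasing (s≤s i<j) (s≤s j<k)
        ; tailBelow    = λ { (suc i) j k<i j<i → tailBelow (suc (suc i)) (suc j) (s≤s k<i) (s≤s j<i) }
        ; tailDiagonal = λ { (suc i) k<i → tailDiagonal (suc (suc i)) (s≤s k<i) }
        }

      chain-10 : M (suc zero) zero ≈ 1#
      chain-10 = ≈-trans (entry (suc zero) zero (s≤s z≤n) z≤n) (h-diagonal (Q 0))

      chain-zero : ∀ i → M (suc (suc i)) zero ≈ 0#
      chain-zero i with suc (toℕ i) ℕ.≤? k
      ... | yes i<k = ≈-trans (entry (suc (suc i)) zero (s≤s i<k) z≤n) (h-zero (increasing (s≤s z≤n) (s≤s i<k)))
      ... | no  i≮k = tailBelow (suc (suc i)) zero (s≤s (ℕ.≰⇒> i≮k)) (s≤s z≤n)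

    -- Induction on I. Cutting at `Q 0` leads to `minor` and to sets S without the first index;
    -- skipping `Q 0` leads to `contract` and to sets S with it. The scalar `γ` absorbs the factors
    -- of `weight`: it becomes 0 on the cut if the first index is in I, and acquires a sign on the
    -- skip if it is not.
    Imm-chain : ∀ {n k a Q} {M : Matrix (suc n)} → k ≤ n → IsChainMatrix M k a Q →
                ∀ {f} → Respects≈ f → (I : Subset k) → ∀ γ →
                (∀ S → f (hessenberg S) ≈ γ * weight I S) → Imm f M ≈ γ * chainSum a (kept I Q) (Q k)
    Imm-chain {k = zero} {a} {Q} {M} _ chain {f} f-resp [] γ f-weight = begin
      Imm f M                                 ≈⟨ Imm-expand₁ f-resp M (λ i → tailBelow (suc i) zero (s≤s z≤n) (s≤s z≤n)) ⟩
      M zero zero * Imm (f ∘ lift₀) (minor M) ≈⟨ *-cong (entry zero zero z≤n z≤n)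
        (Imm-unitriangular (lift₀-resp {f = f} f-resp) (minor M)
          (λ i j j<i → tailBelow (suc i) (suc j) (s≤s z≤n) (s≤s j<i)) (λ i → tailDiagonal (suc i) (s≤s z≤n))) ⟩
      h (Q 0) a * f (lift₀ Perm.id)           ≈⟨ *-congˡ (≈-trans (f-resp (lift₀ Perm.id) Perm.id Perm.lift₀-id)
                                                                  (≈-trans (f-weight []) (*-identityʳ γ))) ⟩
      h (Q 0) a * γ                           ≈⟨ *-comm _ _ ⟩
      γ * h (Q 0) a                           ∎
      where open IsChainMatrix chain
    Imm-chain {suc n} {suc k} {a} {Q} {M} (s≤s k≤n) chain {f} f-resp (inside ∷ I) γ f-weight = begin
      Imm f M                                                ≈⟨ Imm-expand₂ f-resp M (chain-zero chain) ⟩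
      M zero zero * Imm (f ∘ lift₀) (minor M) +ᴬ M (suc zero) zero * Imm (f ∘ glue) (contract M)
        ≈⟨ +-cong (*-congˡ (Imm-chain k≤n (minor-chain chain) (lift₀-resp {f = f} f-resp) I 0#
                     λ S → ≈-trans (f-weight (outside ∷ S)) (≈-trans (zeroʳ γ) (≈-sym (zeroˡ _)))))
                  (*-cong (chain-10 chain) (Imm-chain k≤n (contract-chain chain) (glue-resp {f = f} f-resp) I γ
                     λ S → f-weight (inside ∷ S))) ⟩
      M zero zero * (0# * _) +ᴬ 1# * (γ * chainSum a (kept I (Q ∘ suc)) (Q (suc k)))
        ≈⟨ +-cong (≈-trans (*-congˡ (zeroˡ _)) (zeroʳ _)) (*-identityˡ _) ⟩
      0# +ᴬ γ * chainSum a (kept I (Q ∘ suc)) (Q (suc k))    ≈⟨ +-identityˡ _ ⟩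
      γ * chainSum a (kept I (Q ∘ suc)) (Q (suc k))          ∎
    Imm-chain {suc n} {suc k} {a} {Q} {M} (s≤s k≤n) chain {f} f-resp (outside ∷ I) γ f-weight = begin
      Imm f M                                                ≈⟨ Imm-expand₂ f-resp M (chain-zero chain) ⟩
      M zero zero * Imm (f ∘ lift₀) (minor M) +ᴬ M (suc zero) zero * Imm (f ∘ glue) (contract M)
        ≈⟨ +-cong (*-cong (entry zero zero z≤n z≤n) (Imm-chain k≤n (minor-chain chain) (lift₀-resp {f = f} f-resp) I γ
                     λ S → f-weight (outside ∷ S)))
                  (*-cong (chain-10 chain) (Imm-chain k≤n (contract-chain chain) (glue-resp {f = f} f-resp) I (γ * - 1#)
                     λ S → ≈-trans (f-weight (inside ∷ S)) (≈-sym (*-assoc _ _ _)))) ⟩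
      h (Q 0) a * (γ * cut) +ᴬ 1# * (γ * - 1# * join)
        ≈⟨ +-cong (x∙yz≈y∙xz _ _ _) (≈-trans (*-identityˡ _) (*-assoc _ _ _)) ⟩
      γ * (h (Q 0) a * cut) +ᴬ γ * (- 1# * join)
        ≈⟨ distribˡ γ _ _ ⟨
      γ * (h (Q 0) a * cut +ᴬ - 1# * join) ∎
      where
      open IsChainMatrix chain
      cut  = chainSum (Q 0) (kept I (Q ∘ suc)) (Q (suc k))
      join = chainSum a (kept I (Q ∘ suc)) (Q (suc k))

  sign : ∀ {n} → Permutation′ n → Carrier
  sign w = (- 1#) ^ inversions w

  sign-resp : ∀ {n} → Respects≈ (sign {n})
  sign-resp v w v≈w = reflexive (cong ((- 1#) ^_) (inversions-cong v w v≈w))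

  sign-id : ∀ {n} → sign (Perm.id {n}) ≈ 1#
  sign-id {n} = reflexive (cong ((- 1#) ^_) (inversions-id n))

  -- This makes the determinant the instance I = ∅ of `Imm-chain`: each element of S contributes one
  -- `glue`, hence one inversion. The bound `k ≤ n` keeps `hessenberg` away from its default clause
  -- for subsets that are too long.
  sign-hessenberg : ∀ {n k} → k ≤ n → (S : Subset k) → sign (hessenberg {n} S) ≈ weight ⊥ S
  sign-hessenberg {n} k≤n        []            = sign-id {suc n}
  sign-hessenberg (s≤s {n = n} k≤n) (inside  ∷ S) = ≈-trans
    (reflexive (cong ((- 1#) ^_) (inversions-glue (hessenberg {n} S)))) (*-congˡ (sign-hessenberg k≤n S))
  sign-hessenberg (s≤s {n = n} k≤n) (outside ∷ S) = ≈-trans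
    (reflexive (cong ((- 1#) ^_) (inversions-lift₀ (hessenberg {n} S)))) (sign-hessenberg k≤n S)

-- Ribbons

sorted-unique : ∀ {xs ys} → AllPairs _<_ xs → AllPairs _<_ ys →
                (∀ {z} → z List.∈ xs → z List.∈ ys) → (∀ {z} → z List.∈ ys → z List.∈ xs) → xs ≡ ys
sorted-unique [] []       _ _ = refl
sorted-unique [] (_ ∷ _)  _ ⊇ with ⊇ (here refl)
... | ()
sorted-unique (_ ∷ _) []  ⊆ _ with ⊆ (here refl)
... | ()
sorted-unique {x ∷ xs} {y ∷ ys} (x<xs ∷ xs↗) (y<ys ∷ ys↗) ⊆ ⊇ = cong₂ _∷_ x≡y
  (sorted-unique xs↗ ys↗
    (λ z∈xs → drop (λ { refl → ℕ.<-irrefl x≡y (All.lookup x<xs z∈xs) }) (⊆ (there z∈xs)))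
    (λ z∈ys → drop (λ { refl → ℕ.<-irrefl (sym x≡y) (All.lookup y<ys z∈ys) }) (⊇ (there z∈ys))))
  where
  drop : ∀ {z w} {ws : List ℕ} → z ≢ w → z List.∈ w ∷ ws → z List.∈ ws
  drop z≢w (here z≡w)   = ⊥-elim (z≢w z≡w)
  drop z≢w (there z∈ws) = z∈ws
  x≡y : x ≡ y
  x≡y with ⊆ (here refl) | ⊇ (here refl)
  ... | here e     | _          = e
  ... | there _    | here e     = sym e
  ... | there x∈ys | there y∈xs = ⊥-elim (ℕ.<-asym (All.lookup y<ys x∈ys) (All.lookup x<xs y∈xs))

nth-decreasing : ∀ {ps} → Linked _≥_ ps → ∀ i → nth ps (suc i) ≤ nth ps i
nth-decreasing []       i       = z≤n
nth-decreasing [-]      i       = z≤n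
nth-decreasing (p ∷ ps) zero    = p
nth-decreasing (p ∷ ps) (suc i) = nth-decreasing ps i

nth-beyond : ∀ ps {i} → length ps ≤ i → nth ps i ≡ 0
nth-beyond []       _         = refl
nth-beyond (p ∷ ps) (s≤s l≤i) = nth-beyond ps l≤i

part-decreasing : ∀ P i → part P (suc i) ≤ part P i
part-decreasing P = nth-decreasing (decreasing P)

-- A discrete intermediate value argument: each step changes the row by at most one, so a path from
-- above to below must contain a step from row i down to row i + 1.
path-crosses : ∀ R i {p q} → EqClosure (Neighbour R) p q → proj₁ p ≤ i → i < proj₁ q →
               ∃ λ j → (i , j) ∈ˢ R × (suc i , j) ∈ˢ R
path-crosses R i empty p≤i i<q = ⊥-elim (ℕ.<-irrefl refl (ℕ.<-≤-trans i<q p≤i))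
path-crosses R i (fwd (right _ _) ◅ path) p≤i i<q = path-crosses R i path p≤i i<q
path-crosses R i (bwd (right _ _) ◅ path) p≤i i<q = path-crosses R i path p≤i i<q
path-crosses R i (bwd (below _ _) ◅ path) p≤i i<q = path-crosses R i path (ℕ.<⇒≤ p≤i) i<q
path-crosses R i (fwd (below {r} {j} c c′) ◅ path) p≤i i<q with r ℕ.≟ i
... | yes refl = j , c , c′
... | no r≢i   = path-crosses R i path (ℕ.≤∧≢⇒< p≤i r≢i) i<q

module Ribbon {R : SkewShape} {m} (ribbon : R ∈𝓡 m) where
  open _∈𝓡_ ribbon

  rows : ℕ
  rows = ℓ (outer R)

  nonempty : ∀ {i} → i < rows → part (inner R) i < part (outer R) i
  nonempty {i} = Equivalence.from (nonemptyRows i)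

  outer-beyond : ∀ {i} → rows ≤ i → part (outer R) i ≡ 0
  outer-beyond = nth-beyond (parts (outer R))

  inner-beyond : ∀ {i} → rows ≤ i → part (inner R) i ≡ 0
  inner-beyond {i} l≤i = ℕ.n≤0⇒n≡0 (subst (part (inner R) i ≤_) (outer-beyond l≤i) (inner⊆outer R i))

  -- Adjacent rows share exactly one column. Two shared columns would give a 2×2 block with top left
  -- cell (i, μᵢ), and with none a path between the rows could not cross.
  consecutive : ∀ {i} → suc i < rows → part (outer R) (suc i) ≡ suc (part (inner R) i)
  consecutive {i} 1+i<l = ℕ.≤-antisym upper lower
    where
    upper : part (outer R) (suc i) ≤ suc (part (inner R) i)
    upper = ℕ.≮⇒≥ λ 1+μ<λ → no2×2 i (part (inner R) i)
      ( (ℕ.≤-refl , nonempty (ℕ.<-trans (ℕ.n<1+n i) 1+i<l))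
      , (ℕ.n≤1+n _ , ℕ.≤-trans 1+μ<λ (part-decreasing (outer R) i))
      , (part-decreasing (inner R) i , ℕ.<-trans (ℕ.n<1+n _) 1+μ<λ)
      , (ℕ.≤-trans (part-decreasing (inner R) i) (ℕ.n≤1+n _) , 1+μ<λ) )
    lower : suc (part (inner R) i) ≤ part (outer R) (suc i)
    lower with path-crosses R i (connected (ℕ.≤-refl , nonempty (ℕ.<-trans (ℕ.n<1+n i) 1+i<l))
                                           (ℕ.≤-refl , nonempty 1+i<l)) ℕ.≤-refl ℕ.≤-refl
    ... | j , (μ≤j , _) , (_ , j<λ) = ℕ.≤-<-trans μ≤j j<λ

  inner-position : ∀ j → part (inner R) j + N R (suc j) ≡ part (outer R) j + N R j
  inner-position j = begin
    μ + (N R j + (part (outer R) j ∸ μ)) ≡⟨ cong (ℕ._+_ μ) (ℕ.+-comm (N R j) _) ⟩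
    μ + ((part (outer R) j ∸ μ) + N R j) ≡⟨ ℕ.+-assoc μ _ _ ⟨
    μ + (part (outer R) j ∸ μ) + N R j   ≡⟨ cong (_+ N R j) (ℕ.m+[n∸m]≡n (inner⊆outer R j)) ⟩
    part (outer R) j + N R j             ∎
    where
    open ≡-Reasoning
    μ = part (inner R) j

  -- Along the ribbon, read from the top right cell, the content (column minus row) drops by one per
  -- cell. The last cell of row i comes after N i cells, so its content is that of the first cell
  -- read, diminished by N i.
  outer-position : ∀ {i} → i < rows → part (outer R) i + N R i ≡ part (outer R) 0 + i
  outer-position {zero}  _     = refl
  outer-position {suc i} 1+i<l = begin
    part (outer R) (suc i) + N R (suc i)   ≡⟨ cong (_+ N R (suc i)) (consecutive 1+i<l) ⟩
    suc (part (inner R) i + N R (suc i))   ≡⟨ cong suc (inner-position i) ⟩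
    suc (part (outer R) i + N R i)         ≡⟨ cong suc (outer-position (ℕ.<-trans (ℕ.n<1+n i) 1+i<l)) ⟩
    suc (part (outer R) 0 + i)             ≡⟨ ℕ.+-suc _ i ⟨
    part (outer R) 0 + suc i               ∎
    where open ≡-Reasoning

  N-step : ∀ {i} → i < rows → N R i < N R (suc i)
  N-step {i} i<l = ℕ.m<m+n (N R i) (ℕ.m<n⇒0<n∸m (nonempty i<l))

  N-increasing : ∀ {i j} → i < j → j ≤ rows → N R i < N R j
  N-increasing {i} {suc j} (s≤s i≤j) j<l with i ℕ.≟ j
  ... | yes refl = N-step j<l
  ... | no i≢j   = ℕ.<-trans (N-increasing (ℕ.≤∧≢⇒< i≤j i≢j) (ℕ.<⇒≤ j<l)) (N-step j<l)

  exponent : ℕ → ℕ → ℤ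
  exponent i j = + part (outer R) i ℤ.- + part (inner R) j ℤ.- + i ℤ.+ + j

  private
    -- The common constant `c` cancels. It is λ₀ for two rows of the ribbon and μⱼ for a row beyond
    -- the shape.
    ℤ-identity : ∀ {l n c i u m j} → l + n ≡ c + i → u + m ≡ c + j →
                 + l ℤ.- + u ℤ.- + i ℤ.+ + j ≡ + m ℤ.- + n
    ℤ-identity {l} {n} {c} {i} {u} {m} {j} l+n≡c+i u+m≡c+j = begin
      + l ℤ.- + u ℤ.- + i ℤ.+ + j
        ≡⟨ ring (+ l) (+ u) (+ i) (+ j) (+ m) (+ n) (+ c) ⟩
      (+ m ℤ.- + n) ℤ.+ ((+ l ℤ.+ + n) ℤ.- (+ c ℤ.+ + i)) ℤ.- ((+ u ℤ.+ + m) ℤ.- (+ c ℤ.+ + j))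
        ≡⟨ cong₂ (λ a b → (+ m ℤ.- + n) ℤ.+ a ℤ.- b) (ℤ.i≡j⇒i-j≡0 (cong +_ l+n≡c+i)) (ℤ.i≡j⇒i-j≡0 (cong +_ u+m≡c+j)) ⟩
      (+ m ℤ.- + n) ℤ.+ + 0 ℤ.- + 0
        ≡⟨ trans (ℤ.+-identityʳ _) (ℤ.+-identityʳ _) ⟩
      + m ℤ.- + n ∎
      where
      open ≡-Reasoning
      open ℤSolver.+-*-Solver
      ring : ∀ l u i j m n c → l ℤ.- u ℤ.- i ℤ.+ j ≡
             (m ℤ.- n) ℤ.+ ((l ℤ.+ n) ℤ.- (c ℤ.+ i)) ℤ.- ((u ℤ.+ m) ℤ.- (c ℤ.+ j))
      ring = solve 7 (λ l u i j m n c → l :- u :- i :+ j :=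
             (m :- n) :+ ((l :+ n) :- (c :+ i)) :- ((u :+ m) :- (c :+ j))) refl

  exponent-rows : ∀ {i j} → i < rows → j < rows → exponent i j ≡ + N R (suc j) ℤ.- + N R i
  exponent-rows {i} {j} i<l j<l = ℤ-identity
    {l = part (outer R) i} {n = N R i} {c = part (outer R) 0} {u = part (inner R) j} {m = N R (suc j)}
    (outer-position i<l) (trans (inner-position j) (outer-position j<l))

  exponent-beyond : ∀ {i j} → rows ≤ i → exponent i j ≡ + j ℤ.- + (part (inner R) j + i)
  exponent-beyond {i} {j} l≤i = ℤ-identity
    {l = part (outer R) i} {n = μ + i} {c = μ} {u = μ} {m = j}
    (cong (_+ (μ + i)) (outer-beyond l≤i)) refl
    where μ = part (inner R) j

-- Jacobi–Trudi matrices of ribbons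

q<p⇒q-p≡-1+ : ∀ {q p} → q < p → ∃ λ k → + q ℤ.- + p ≡ -[1+ k ]
q<p⇒q-p≡-1+ {q} {p} q<p with p ∸ q in eq
... | zero  = ⊥-elim (ℕ.<⇒≢ (ℕ.m<n⇒0<n∸m q<p) (sym eq))
... | suc k = k , trans (ℤ.m-n≡m⊖n q p) (trans (ℤ.⊖-< q<p) (cong (ℤ.-_ ∘ +_) eq))

∈-kept⁻ : ∀ {k z} (I : Subset k) {Q} → z List.∈ kept I Q → ∃ λ j → j ∈ ∁ I × z ≡ Q (toℕ j)
∈-kept⁻ (inside ∷ I) z∈ with ∈-kept⁻ I z∈
... | j , j∈ , z≡ = suc j , there j∈ , z≡
∈-kept⁻ (outside ∷ I) (here z≡) = zero , here , z≡
∈-kept⁻ (outside ∷ I) (there z∈) with ∈-kept⁻ I z∈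
... | j , j∈ , z≡ = suc j , there j∈ , z≡

∈-kept⁺ : ∀ {k} (I : Subset k) {Q j} → j ∈ ∁ I → Q (toℕ j) List.∈ kept I Q
∈-kept⁺ (inside  ∷ I) (there j∈) = ∈-kept⁺ I j∈
∈-kept⁺ (outside ∷ I) here       = here refl
∈-kept⁺ (outside ∷ I) (there j∈) = there (∈-kept⁺ I j∈)

kept-sorted : ∀ {k} (I : Subset k) {Q} → (∀ {i j} → i < j → j < k → Q i < Q j) → AllPairs _<_ (kept I Q)
kept-sorted []            Q↗ = []
kept-sorted (inside  ∷ I) Q↗ = kept-sorted I (λ i<j j<k → Q↗ (s≤s i<j) (s≤s j<k))
kept-sorted (outside ∷ I) {Q} Q↗ =
  All.tabulate first ∷ kept-sorted I (λ i<j j<k → Q↗ (s≤s i<j) (s≤s j<k))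
  where
  first : ∀ {z} → z List.∈ kept I (Q ∘ suc) → Q 0 < z
  first z∈ with ∈-kept⁻ I z∈
  ... | j , _ , refl = Q↗ (s≤s z≤n) (s≤s (Fin.toℕ<n j))

module _ {m R R-I} (ribbon : R ∈𝓡 m) (ribbon-I : R-I ∈𝓡 m) {k k′} (I : Subset k)
         (ℓ≡ : ℓ (outer R) ≡ suc k) (ℓ-I≡ : ℓ (outer R-I) ≡ suc k′) (Des≐ : Des R-I ≐ d (∁ I) R) where

  private
    increasing : ∀ {R m k} (ribbon : R ∈𝓡 m) → ℓ (outer R) ≡ suc k → ∀ {i j} → i < j → j < k → N R (suc i) < N R (suc j)
    increasing ribbon ℓ≡ i<j j<k = Ribbon.N-increasing ribbon (s≤s i<j)
      (subst (_ ≤_) (sym ℓ≡) (s≤s (ℕ.<⇒≤ j<k)))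

  -- Descent sets are given as predicates, but `chainSum` consumes lists. Both lists are strictly
  -- increasing because all rows are nonempty, so having the same elements makes them equal.
  kept-Des : kept {k′} ⊥ (N R-I ∘ suc) ≡ kept I (N R ∘ suc)
  kept-Des = sorted-unique (kept-sorted (⊥ {k′}) (increasing ribbon-I ℓ-I≡)) (kept-sorted I (increasing ribbon ℓ≡)) ⊆ ⊇
    where
    ⊆ : ∀ {z} → z List.∈ kept {k′} ⊥ (N R-I ∘ suc) → z List.∈ kept I (N R ∘ suc)
    ⊆ z∈ with ∈-kept⁻ (⊥ {k′}) z∈
    ... | j , _ , refl with proj₁ Des≐ (suc (toℕ j) , s≤s z≤n , subst (_ <_) (sym ℓ-I≡) (s≤s (Fin.toℕ<n j)) , refl)
    ... | i , i∈ , z≡ = subst (List._∈ kept I (N R ∘ suc)) (sym z≡) (∈-kept⁺ I {N R ∘ suc} i∈)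
    ⊇ : ∀ {z} → z List.∈ kept I (N R ∘ suc) → z List.∈ kept {k′} ⊥ (N R-I ∘ suc)
    ⊇ z∈ with ∈-kept⁻ I z∈
    ... | j , j∈ , refl with proj₂ Des≐ (j , j∈ , refl)
    ... | suc i , _ , i<ℓ , z≡ = subst (List._∈ kept {k′} ⊥ (N R-I ∘ suc))
      (sym (trans z≡ (cong (N R-I ∘ suc) (sym (Fin.toℕ-fromℕ< i<k′)))))
      (∈-kept⁺ (⊥ {k′}) {N R-I ∘ suc} {fromℕ< i<k′} (x∉p⇒x∈∁p ∉⊥))
      where i<k′ = ℕ.s≤s⁻¹ (subst (_ <_) ℓ-I≡ i<ℓ)

rows-positive : ∀ {R m} → R ∈𝓡 m → 0 < ℓ (outer R) → 0 < m
rows-positive {R} ribbon 0<ℓ = subst (0 <_) (_∈𝓡_.size≡ ribbon) (Ribbon.N-increasing ribbon 0<ℓ ℕ.≤-refl)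

module JacobiTrudi {a ℓa} (A : CommutativeRing a ℓa) where

  open CommutativeRing A hiding (zero) renaming (_+_ to _+ᴬ_; refl to ≈-refl; sym to ≈-sym; trans to ≈-trans)
  open import Algebra.Definitions.RawSemiring (Semiring.rawSemiring (CommutativeRing.semiring A)) using (product)
  open Immanants A
  open Expansions A
  open SubsetWeights A
  open SetoidReasoning setoid

  private
    monomial : ∀ {v} → (Fin v → Carrier) → Subset v → Carrier
    monomial x S = product λ i → if lookup S i then x i else 1#

    ∑-inside : ∀ {v} (x : Fin (suc v) → Carrier) (Ss : List (Subset v)) →
               ∑ (map (monomial x) (filter (λ S → ∣ S ∣ ℕ.≟ 0) (map (inside ∷_) Ss))) ≈ 0#
    ∑-inside x []       = ≈-refl
    ∑-inside x (S ∷ Ss) = ∑-inside x Ss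

    ∑-outside : ∀ {v} (x : Fin (suc v) → Carrier) (Ss : List (Subset v)) →
                ∑ (map (monomial x) (filter (λ S → ∣ S ∣ ℕ.≟ 0) (map (outside ∷_) Ss))) ≈
                ∑ (map (monomial (x ∘ suc)) (filter (λ S → ∣ S ∣ ℕ.≟ 0) Ss))
    ∑-outside x []       = ≈-refl
    ∑-outside x (S ∷ Ss) with does (∣ S ∣ ℕ.≟ 0)
    ... | true  = +-cong (*-identityˡ _) (∑-outside x Ss)
    ... | false = ∑-outside x Ss

  e-zero : ∀ {v} (x : Fin v → Carrier) → e 0 x ≈ 1#
  e-zero {zero}  x = +-identityʳ 1#
  e-zero {suc v} x = begin
    ∑ (map (monomial x) (filter P? (map (outside ∷_) (subsets v) ++ map (inside ∷_) (subsets v))))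
      ≡⟨ cong (∑ ∘ map (monomial x)) (List.filter-++ P? (map (outside ∷_) (subsets v)) _) ⟩
    ∑ (map (monomial x) (filter P? (map (outside ∷_) (subsets v)) ++ filter P? (map (inside ∷_) (subsets v))))
      ≡⟨ cong ∑ (List.map-++ (monomial x) (filter P? (map (outside ∷_) (subsets v))) _) ⟩
    ∑ (map (monomial x) (filter P? (map (outside ∷_) (subsets v))) ++
       map (monomial x) (filter P? (map (inside ∷_) (subsets v))))
      ≈⟨ ∑-++ (map (monomial x) (filter P? (map (outside ∷_) (subsets v)))) _ ⟩
    ∑ (map (monomial x) (filter P? (map (outside ∷_) (subsets v)))) +ᴬ
    ∑ (map (monomial x) (filter P? (map (inside ∷_) (subsets v))))
      ≈⟨ +-cong (∑-outside x (subsets v)) (∑-inside x (subsets v)) ⟩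
    e 0 (x ∘ suc) +ᴬ 0# ≈⟨ ≈-trans (+-identityʳ _) (e-zero (x ∘ suc)) ⟩
    1# ∎
    where
    P? = λ (S : Subset (suc v)) → ∣ S ∣ ℕ.≟ 0

  module _ {k} .{{_ : NonZero k}} {vars : Fin k → ℕ} (x : ∀ r → Fin (vars r) → Carrier) where

    eₓ : ℤ → Carrier
    eₓ z = product λ r → eℤ z (x r)

    h : ℕ → ℕ → Carrier
    h q p = eₓ (+ q ℤ.- + p)

    h-diagonal : ∀ p → h p p ≈ 1#
    h-diagonal p = ≈-trans (reflexive (cong eₓ (ℤ.+-inverseʳ (+ p)))) (product-one {g = λ r → e 0 (x r)} λ r → e-zero (x r))

    h-zero : ∀ {q p} → q < p → h q p ≈ 0#
    h-zero q<p with q<p⇒q-p≡-1+ q<p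
    ... | l , eq = ≈-trans (reflexive (cong eₓ eq)) (negative k)
      where
      -- The empty product would be 1, so at least one variable set is required for the zeros below
      -- the subdiagonal; this is where `NonZero k` enters.
      negative : ∀ k .{{_ : NonZero k}} → product {k} (λ _ → 0#) ≈ 0#
      negative (suc k) = zeroˡ _

    open Chains h h-diagonal h-zero

    JT* : ∀ R n → Matrix n
    JT* R n = Hadamard λ r → JT R n (x r)

    module _ {R m} (ribbon : R ∈𝓡 m) where
      open Ribbon ribbon

      JT*-below : ∀ {n} (i j : Fin n) → rows ≤ toℕ i → toℕ j < toℕ i → JT* R n i j ≈ 0#
      JT*-below i j ℓ≤i j<i = ≈-trans (reflexive (cong eₓ (exponent-beyond {toℕ i} {toℕ j} ℓ≤i)))
        (h-zero (ℕ.<-≤-trans j<i (ℕ.m≤n+m (toℕ i) (part (inner R) (toℕ j)))))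

      JT*-diagonal : ∀ {n} (i : Fin n) → rows ≤ toℕ i → JT* R n i i ≈ 1#
      JT*-diagonal i ℓ≤i = ≈-trans (reflexive (cong eₓ (trans (exponent-beyond {toℕ i} {toℕ i} ℓ≤i)
        (cong (λ z → + toℕ i ℤ.- + (z + toℕ i)) (inner-beyond ℓ≤i))))) (h-diagonal (toℕ i))

      -- The end of row i, counted from 0, is N (i + 1), and the first row starts at N 0 = 0. This
      -- is the reason for the shift `N R ∘ suc` and for `a = 0`.
      JT*-chain : ∀ {n k} → rows ≡ suc k → IsChainMatrix (JT* R (suc n)) k 0 (N R ∘ suc)
      JT*-chain {n} {k} ℓ≡ = record
        { entry        = λ i j i≤k j≤k → reflexive (cong eₓ (trans
            (exponent-rows (subst (_ <_) (sym ℓ≡) (s≤s i≤k)) (subst (_ <_) (sym ℓ≡) (s≤s j≤k)))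
            (cong (λ p → + N R (suc (toℕ j)) ℤ.- + p) (N≡rowStart (toℕ i)))))
        ; increasing   = λ i<j j<k → N-increasing (s≤s i<j) (subst (_ ≤_) (sym ℓ≡) (s≤s (ℕ.<⇒≤ j<k)))
        ; tailBelow    = λ i j k<i → JT*-below i j (subst (_≤ toℕ i) (sym ℓ≡) k<i)
        ; tailDiagonal = λ i k<i → JT*-diagonal i (subst (_≤ toℕ i) (sym ℓ≡) k<i)
        }
        where
        N≡rowStart : ∀ i → N R i ≡ rowStart 0 (N R ∘ suc) i
        N≡rowStart zero    = refl
        N≡rowStart (suc i) = refl

    module _ (R : SkewShape) {m} (ribbon : R ∈𝓡 m) where
      open Ribbon ribbon

      det-ribbon : ∀ {n k} → rows ≡ suc k → rows ≤ n → det (JT* R n) ≈ chainSum 0 (kept {k} ⊥ (N R ∘ suc)) m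
      det-ribbon {suc n} {k} ℓ≡ ℓ≤n = begin
        det (JT* R (suc n))
          ≈⟨ Imm-chain k≤n (JT*-chain ribbon ℓ≡) sign-resp ⊥ 1#
               (λ S → ≈-trans (sign-hessenberg k≤n S) (≈-sym (*-identityˡ _))) ⟩
        1# * chainSum 0 (kept {k} ⊥ (N R ∘ suc)) (N R (suc k))
          ≈⟨ *-identityˡ _ ⟩
        chainSum 0 (kept {k} ⊥ (N R ∘ suc)) (N R (suc k))
          ≡⟨ cong (chainSum 0 (kept {k} ⊥ (N R ∘ suc))) (trans (cong (N R) (sym ℓ≡)) (_∈𝓡_.size≡ ribbon)) ⟩
        chainSum 0 (kept {k} ⊥ (N R ∘ suc)) m ∎
        where k≤n = ℕ.s≤s⁻¹ (subst (_≤ suc n) ℓ≡ ℓ≤n)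
      det-ribbon {zero} ℓ≡ ℓ≤n with subst (_≤ 0) ℓ≡ ℓ≤n
      ... | ()

      det-empty : ∀ {n} → rows ≡ 0 → det (JT* R n) ≈ 1#
      det-empty {n} ℓ≡0 = ≈-trans
        (Imm-unitriangular (sign-resp {n}) (JT* R n)
          (λ i j → JT*-below ribbon i j (subst (_≤ toℕ i) (sym ℓ≡0) z≤n))
          (λ i → JT*-diagonal ribbon i (subst (_≤ toℕ i) (sym ℓ≡0) z≤n)))
        (sign-id {n})

      Imm-ribbon : ∀ {k} → rows ≡ suc k → ∀ {f} → Respects≈ f → (I : Subset k) →
                   (∀ S → f (hessenberg S) ≈ weight I S) →
                   Imm f (JT* R (suc k)) ≈ chainSum 0 (kept I (N R ∘ suc)) m
      Imm-ribbon {k} ℓ≡ {f} f-resp I f-weight = begin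
        Imm f (JT* R (suc k))
          ≈⟨ Imm-chain ℕ.≤-refl (JT*-chain ribbon ℓ≡) f-resp I 1# (λ S → ≈-trans (f-weight S) (≈-sym (*-identityˡ _))) ⟩
        1# * chainSum 0 (kept I (N R ∘ suc)) (N R (suc k))
          ≈⟨ *-identityˡ _ ⟩
        chainSum 0 (kept I (N R ∘ suc)) (N R (suc k))
          ≡⟨ cong (chainSum 0 (kept I (N R ∘ suc))) (trans (cong (N R) (sym ℓ≡)) (_∈𝓡_.size≡ ribbon)) ⟩
        chainSum 0 (kept I (N R ∘ suc)) m ∎

-- Transfer of the coefficients from K to A, and the theorem

module _ {a ℓa c ℓc} (K : CommutativeRing c ℓc) (A : CommutativeRing a ℓa) where
  private
    module K = CommutativeRing K
    module A = CommutativeRing A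
    module WK = SubsetWeights K
    module WA = SubsetWeights A

  -- Of the values of `f`, only those on the permutations w_S reach the result. They are built from
  -- 0, 1 and -1, which every ring homomorphism preserves, so the outcome is the same for all `φ`.
  weight-homo : ∀ {φ} → IsRingHomomorphism K.rawRing A.rawRing φ →
                ∀ {r} (I S : Subset r) → φ (WK.weight I S) A.≈ WA.weight I S
  weight-homo {φ} φ-homo = go
    where
    open IsRingHomomorphism φ-homo
    go : ∀ {r} (I S : Subset r) → φ (WK.weight I S) A.≈ WA.weight I S
    go []            []            = 1#-homo
    go (inside  ∷ I) (inside  ∷ S) = go I S
    go (inside  ∷ I) (outside ∷ S) = 0#-homo
    go (outside ∷ I) (inside  ∷ S) = A.trans (*-homo _ _)
      (A.*-cong (A.trans (-‿homo K.1#) (A.-‿cong 1#-homo)) (go I S))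
    go (outside ∷ I) (outside ∷ S) = go I S

module _ {c ℓc} (K : CommutativeRing c ℓc) where
  open CommutativeRing K renaming (trans to ≈-trans)
  open SubsetWeights K

  TLFunction-hessenberg : ∀ k (I : Subset k) {f} → TemperleyLieb.IsTLFunction K (suc k) (Diagrams.τ (suc k) I) f →
                        ∀ S → f (hessenberg S) ≈ weight I S
  TLFunction-hessenberg k I isTLFunction S =
    ≈-trans (Coefficients.TLFunction-cong K (suc k) isTLFunction (hessenberg≈product-s S))
            (Coefficients.TLFunction-product-s K (suc k) I isTLFunction S)

mainTheorem10 : ∀ {a ℓa c ℓc} (K : CommutativeRing c ℓc) (A : CommutativeRing a ℓa) →
    let module K = CommutativeRing K
        module A = CommutativeRing A
        open TemperleyLieb K
        open Immanants A
    in
    (φ : K.Carrier → A.Carrier) → IsRingHomomorphism K.rawRing A.rawRing φ →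
    (m n : ℕ) (R : SkewShape) → R ∈𝓡 m → ℓ (outer R) ≡ n →
    (I : Subset (n ∸ 1)) (R-I : SkewShape) → R-I ∈𝓡 m → Des R-I ≐ d (∁ I) R →
    (k : ℕ) .{{_ : NonZero k}} (vars : Fin k → ℕ) (x : ∀ r → Fin (vars r) → A.Carrier) →
    (f : Permutation′ n → K.Carrier) → IsTLFunction n (Diagrams.τ n I) f →
    (n′ : ℕ) → ℓ (outer R-I) ≤ n′ →
    Imm (λ w → φ (f w)) (Hadamard (λ r → JT R n (x r)))
      A.≈ det (Hadamard (λ r → JT R-I n′ (x r)))
mainTheorem10 K A φ φ-homo m n R ribbon ℓ≡n I R-I ribbon-I Des≐ k vars x f isTLFunction n′ ℓ-I≤n′ =
  go n ℓ≡n I Des≐ f isTLFunction (ℓ (outer R-I)) refl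
  where
  module A = CommutativeRing A
  open Immanants A
  open JacobiTrudi A
  open Expansions A
  open IsRingHomomorphism φ-homo
  go : ∀ n → ℓ (outer R) ≡ n → (I : Subset (n ∸ 1)) → Des R-I ≐ d (∁ I) R →
       ∀ f → TemperleyLieb.IsTLFunction K n (Diagrams.τ n I) f → ∀ l → ℓ (outer R-I) ≡ l →
       Imm (λ w → φ (f w)) (JT* x R n) A.≈ det (JT* x R-I n′)
  -- The empty ribbon: the immanant is the value of `f` at the only permutation, which is 1, and a
  -- determinant of any size n′ is unitriangular.
  go zero ℓ≡0 [] Des≐ f isTL zero ℓ-I≡0 = A.trans
    (A.trans (A.+-identityʳ _) (A.*-identityʳ _))
    (A.trans (A.trans (⟦⟧-cong (Coefficients.TLFunction-product-s K 0 [] isTL [])) 1#-homo)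
             (A.sym (det-empty x R-I ribbon-I {n′} ℓ-I≡0)))
  -- One shape empty and the other not is impossible, as both have `m` cells.
  go zero ℓ≡0 I Des≐ f isTL (suc l) ℓ-I≡ = ⊥-elim (ℕ.<-irrefl
    (trans (cong (N R) (sym ℓ≡0)) (_∈𝓡_.size≡ ribbon))
    (rows-positive ribbon-I (subst (0 <_) (sym ℓ-I≡) (s≤s z≤n))))
  go (suc k) ℓ≡ I Des≐ f isTL zero ℓ-I≡ = ⊥-elim (ℕ.<-irrefl
    (trans (cong (N R-I) (sym ℓ-I≡)) (_∈𝓡_.size≡ ribbon-I))
    (rows-positive ribbon (subst (0 <_) (sym ℓ≡) (s≤s z≤n))))
  go (suc k) ℓ≡ I Des≐ f isTL (suc k′) ℓ-I≡ = A.trans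
    (Imm-ribbon x R ribbon ℓ≡
      (λ v w v≈w → ⟦⟧-cong (Coefficients.TLFunction-cong K (suc k) isTL v≈w)) I
      (λ S → A.trans (⟦⟧-cong (TLFunction-hessenberg K k I isTL S)) (weight-homo K A φ-homo I S)))
    (A.trans (A.reflexive (cong (λ ps → Chains.chainSum (h x) (h-diagonal x) (h-zero x) 0 ps m)
                (sym (kept-Des ribbon ribbon-I I ℓ≡ ℓ-I≡ Des≐))))
             (A.sym (det-ribbon x R-I ribbon-I ℓ-I≡ ℓ-I≤n′)))
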